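{- Let $V$ be a real normed space of finite dimension $d\ge 1$, let $U$ be an abelian group with a translation-invariant ultrametric, let $\Lambda\subset V\times U$ be a closed additive subgroup, and let $X=(V\times U)/\Lambda$ carry the quotient metric induced by the maximum product metric. Let $\overline V=V/W$ be the reduced real factor. Then for every $\alpha\in X$ and every integer $N\ge 2$, $$g_N(\alpha)\le P(\overline V)+1.$$ If in addition $V$ is an inner-product space (its norm is induced by an inner product), then, with $E_\Lambda$ the effective real factor, for every $\alpha\in X$ and every $N\ge2$, $$g_N(\alpha)\le P(E_\Lambda)+1.$$
   Context: Metric setting. Write the ultrametric on $U$ as $d_U(u,w)=|u-w|_U$, so $|u+w|_U\le\max\{|u|_U,|w|_U\}$. On $V\times U$ put $|(v,u)|=\max\{\|v\|_V,|u|_U\}$; "closed" refers to the induced metric topology. On $X=(V\times U)/\Lambda$ put $\|a+\Lambda\|_X=\inf_{\lambda\in\Lambda}|a-\lambda|$ and $d_X(x,y)=\|x-y\|_X$ (a metric because $\Lambda$ is closed). Neither compactness of $X$ nor discreteness of $\Lambda$ is assumed. Nearest-neighbour distances. For $\alpha\in X$ and $N\ge2$ let $\mathcal O_N(\alpha)=\{0,\alpha,\dots,(N-1)\alpha\}$ as a set (repetitions discarded). If it has at least two points put $\delta_N(x)=\min_{y\in\mathcal O_N(\alpha),\,y\ne x}d_X(x,y)$ and $g_N(\alpha)=\#\{\delta_N(x):x\in\mathcal O_N(\alpha)\}$; if it is a singleton, $g_N(\alpha)=0$. Packing number. For a finite-dimensional real normed space $Y$, $P(Y)$ is the maximal cardinality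 of a set $S\subset\{v\in Y:\|v\|_Y<1\}$ (open unit ball) with $\|v-w\|_Y\ge1$ for all distinct $v,w\in S$. This maximum is finite, and $P(\{0\})=1$. Reduced real factor. $W=\{v\in V:(tv,0)\in\Lambda\text{ for every }t\in\mathbb R\}$, a linear subspace of $V$; $\overline V=V/W$ with the quotient norm. Effective real factor (when $V$ is an inner-product space). Let $\pi:V\to W^\perp$ be orthogonal projection. Then $E_\Lambda=\operatorname{span}_{\mathbb R}\{\pi(v):(v,u)\in\Lambda\}\subset W^\perp$, with the induced inner product and norm. -}

module Defs where

open import Algebra.Bundles using (AbelianGroup; CommutativeRing)
import Algebra.Construct.DirectProduct as DirectProduct
import Algebra.Construct.NaturalChoice.Max as Max
import Algebra.Definitions.RawMonoid as RawMonoidDefinitions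
open import Algebra.Module.Bundles using (LeftModule)
import Algebra.Properties.AbelianGroup as AbelianGroupProperties
import Algebra.Properties.CommutativeSemigroup as CommutativeSemigroupProperties
import Algebra.Properties.Ring as RingProperties
open import Axiom.ExcludedMiddle using (ExcludedMiddle)
open import Data.Empty using (⊥-elim)
open import Data.Fin.Base using (Fin)
open import Data.Nat.Base as ℕ using (ℕ)
open import Data.Product.Base using (Σ; ∃; ∃-syntax; _×_; _,_; proj₁; proj₂)
open import Data.Sum.Base using (_⊎_; inj₁; inj₂)
open import Function.Definitions using (Injective)
open import Function.Metric.Definitions using (TranslationInvariant)
open import Function.Metric.Structures using (IsGeneralMetric)
open import Level using (Level; suc)
open import Relation.Binary.Bundles using (DecTotalOrder; Setoid)
open import Relation.Binary.Core using (Rel)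
import Relation.Binary.Construct.NonStrictToStrict as NonStrictToStrict
open import Relation.Binary.PropositionalEquality.Core using (_≡_)
import Relation.Binary.Reasoning.PartialOrder as ≤-Reasoning
import Relation.Binary.Reasoning.Setoid as ≈-Reasoning
open import Relation.Binary.Structures using (IsDecTotalOrder)
open import Relation.Nullary using (¬_; yes; no)

-- The reals are any complete ordered field.  The field is understood
-- classically: the order is decidable, and a supremum is an upper bound
-- approximated from below by elements of the set, which is the least
-- upper bound property read with excluded middle.  In fact these axioms
-- imply excluded middle (see excludedMiddle below), so that statements
-- over such a field have their classical meaning.

record CompleteOrderedField (ℓ : Level) : Set (suc ℓ) where
  infix 4 _≤_ _<_
  field
    commutativeRing : CommutativeRing ℓ ℓ
  open CommutativeRing commutativeRing public
  field
    _≤_             : Rel Carrier ℓ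
    isDecTotalOrder : IsDecTotalOrder _≈_ _≤_

  _<_ : Rel Carrier ℓ
  _<_ = NonStrictToStrict._<_ _≈_ _≤_

  IsSupremum : (Carrier → Set ℓ) → Carrier → Set ℓ
  IsSupremum S s = (∀ {x} → S x → x ≤ s)
                 × (∀ {y} → y < s → ∃[ x ] S x × y < x)

  field
    0≉1             : ¬ 0# ≈ 1#
    inverse         : ∀ x → ¬ x ≈ 0# → ∃[ y ] x * y ≈ 1#
    +-monoˡ-≤       : ∀ z {x y} → x ≤ y → x + z ≤ y + z
    *-nonneg        : ∀ {x y} → 0# ≤ x → 0# ≤ y → 0# ≤ x * y
    supremum        : (S : Carrier → Set ℓ) → ∃ S →
                      ∃[ b ] (∀ {x} → S x → x ≤ b) → ∃ (IsSupremum S)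

  decTotalOrder : DecTotalOrder ℓ ℓ ℓ
  decTotalOrder = record { isDecTotalOrder = isDecTotalOrder }

  open DecTotalOrder decTotalOrder public
    using (_≤?_; total; totalOrder; poset)
    renaming ( refl to ≤-refl; reflexive to ≤-reflexive
             ; trans to ≤-trans; antisym to ≤-antisym )

  open Max totalOrder public
    using ( _⊔_; ⊔-cong; ⊔-comm; ⊔-lub; ⊔-sel; x≤x⊔y; x≤y⊔x; ⊔-mono-≤
          ; x≤y⇒x≤y⊔z; x≤y⇒x≤z⊔y )

  ∣_∣ : Carrier → Carrier
  ∣ x ∣ = x ⊔ (- x)

  IsInfimum : (Carrier → Set ℓ) → Carrier → Set ℓ
  IsInfimum S r = (∀ {x} → S x → r ≤ x)
                × (∀ {y} → r < y → ∃[ x ] S x × x < y)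

  IsMinimum : (Carrier → Set ℓ) → Carrier → Set ℓ
  IsMinimum S r = S r × (∀ {x} → S x → r ≤ x)

  private
    module RP = RingProperties ring
    module AP = AbelianGroupProperties +-abelianGroup

  ≰⇒> : ∀ {x y} → ¬ x ≤ y → y < x
  ≰⇒> {x} {y} x≰y with total x y
  ... | inj₁ x≤y = ⊥-elim (x≰y x≤y)
  ... | inj₂ y≤x = y≤x , λ y≈x → x≰y (≤-reflexive (sym y≈x))

  <⇒≱ : ∀ {x y} → x < y → ¬ y ≤ x
  <⇒≱ (x≤y , x≉y) y≤x = x≉y (≤-antisym x≤y y≤x)

  +-mono-≤ : ∀ {a b x y} → a ≤ b → x ≤ y → a + x ≤ b + y
  +-mono-≤ {a} {b} {x} {y} a≤b x≤y = begin
    a + x  ≤⟨ +-monoˡ-≤ x a≤b ⟩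
    b + x  ≈⟨ +-comm b x ⟩
    x + b  ≤⟨ +-monoˡ-≤ b x≤y ⟩
    y + b  ≈⟨ +-comm y b ⟩
    b + y  ∎
    where open ≤-Reasoning poset

  x+z≤y⇒x≤y-z : ∀ {x y z} → x + z ≤ y → x ≤ y - z
  x+z≤y⇒x≤y-z {x} {y} {z} le = begin
    x          ≈⟨ AP.//-rightDividesʳ z x ⟨
    x + z - z  ≤⟨ +-monoˡ-≤ (- z) le ⟩
    y - z      ∎
    where open ≤-Reasoning poset

  x-z≤y⇒x≤y+z : ∀ {x y z} → x - z ≤ y → x ≤ y + z
  x-z≤y⇒x≤y+z {x} {y} {z} le = begin
    x            ≈⟨ AP.//-rightDividesˡ z x ⟨
    x - z + z    ≤⟨ +-monoˡ-≤ z le ⟩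
    y + z        ∎
    where open ≤-Reasoning poset

  neg-mono-≤ : ∀ {x y} → x ≤ y → - y ≤ - x
  neg-mono-≤ {x} {y} x≤y = begin
    - y      ≤⟨ x+z≤y⇒x≤y-z (begin
                  - y + x  ≤⟨ +-mono-≤ ≤-refl x≤y ⟩
                  - y + y  ≈⟨ -‿inverseˡ y ⟩
                  0#       ∎) ⟩
    0# - x   ≈⟨ +-identityˡ (- x) ⟩
    - x      ∎
    where open ≤-Reasoning poset

  neg-cancel-< : ∀ {x y} → x < y → - y < - x
  neg-cancel-< (x≤y , x≉y) =
    neg-mono-≤ x≤y , λ -y≈-x → x≉y (sym (AP.⁻¹-injective -y≈-x))

  0≤1 : 0# ≤ 1#
  0≤1 with total 0# 1#
  ... | inj₁ 0≤1 = 0≤1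
  ... | inj₂ 1≤0 = begin
    0#             ≤⟨ *-nonneg 0≤-1 0≤-1 ⟩
    - 1# * - 1#    ≈⟨ RP.-1*x≈-x (- 1#) ⟩
    - - 1#         ≈⟨ AP.⁻¹-involutive 1# ⟩
    1#             ∎
    where
    open ≤-Reasoning poset
    0≤-1 : 0# ≤ - 1#
    0≤-1 = begin
      0#    ≈⟨ AP.ε⁻¹≈ε ⟨
      - 0#  ≤⟨ neg-mono-≤ 1≤0 ⟩
      - 1#  ∎

  *-monoʳ-≤ : ∀ {z x y} → 0# ≤ z → x ≤ y → x * z ≤ y * z
  *-monoʳ-≤ {z} {x} {y} 0≤z x≤y = begin
    x * z                    ≈⟨ +-identityˡ _ ⟨
    0# + x * z               ≤⟨ +-monoˡ-≤ (x * z) (*-nonneg 0≤y-x 0≤z) ⟩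
    (y - x) * z + x * z      ≈⟨ distribʳ z (y - x) x ⟨
    (y - x + x) * z          ≈⟨ *-congʳ (AP.//-rightDividesˡ x y) ⟩
    y * z                    ∎
    where
    open ≤-Reasoning poset
    0≤y-x : 0# ≤ y - x
    0≤y-x = x+z≤y⇒x≤y-z (≤-trans (≤-reflexive (+-identityˡ x)) x≤y)

  ∣x∣-nonneg : ∀ x → 0# ≤ ∣ x ∣
  ∣x∣-nonneg x with total 0# x
  ... | inj₁ 0≤x = ≤-trans 0≤x (x≤x⊔y x (- x))
  ... | inj₂ x≤0 = begin
    0#      ≈⟨ AP.ε⁻¹≈ε ⟨
    - 0#    ≤⟨ neg-mono-≤ x≤0 ⟩
    - x     ≤⟨ x≤y⊔x x (- x) ⟩
    ∣ x ∣   ∎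
    where open ≤-Reasoning poset

  ∣-1∣≈1 : ∣ - 1# ∣ ≈ 1#
  ∣-1∣≈1 = ≤-antisym
    (⊔-lub (≤-trans -1≤0 0≤1) (≤-reflexive (AP.⁻¹-involutive 1#)))
    (≤-trans (≤-reflexive (sym (AP.⁻¹-involutive 1#))) (x≤y⊔x (- 1#) (- - 1#)))
    where
    -1≤0 : - 1# ≤ 0#
    -1≤0 = ≤-trans (neg-mono-≤ 0≤1) (≤-reflexive AP.ε⁻¹≈ε)

  excludedMiddle : ExcludedMiddle ℓ
  excludedMiddle {P} with supremum S (0# , inj₁ refl) (1# , S≤1)
    where
    S : Carrier → Set ℓ
    S x = x ≈ 0# ⊎ (x ≈ 1# × P)
    S≤1 : ∀ {x} → S x → x ≤ 1#
    S≤1 (inj₁ x≈0)       = ≤-trans (≤-reflexive x≈0) 0≤1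
    S≤1 (inj₂ (x≈1 , _)) = ≤-reflexive x≈1
  ... | s , upper , approx with s ≤? 0#
  ... | yes s≤0 = no λ p → 0≉1 (≤-antisym 0≤1 (≤-trans (upper (inj₂ (refl , p))) s≤0))
  ... | no  s≰0 with approx (≰⇒> s≰0)
  ... | x , inj₁ x≈0 , _ , 0≉x = ⊥-elim (0≉x (sym x≈0))
  ... | x , inj₂ (_ , p) , _   = yes p

  infimum : (S : Carrier → Set ℓ) → ∃ S →
            ∃[ b ] (∀ {x} → S x → b ≤ x) → ∃ (IsInfimum S)
  infimum S (x₀ , Sx₀) (b , b≤) with supremum S⁻ (- x₀ , x₀ , Sx₀ , refl) (- b , S⁻≤-b)
    where
    S⁻ : Carrier → Set ℓ
    S⁻ x = ∃[ y ] S y × x ≈ - y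
    S⁻≤-b : ∀ {x} → S⁻ x → x ≤ - b
    S⁻≤-b (y , Sy , x≈-y) = ≤-trans (≤-reflexive x≈-y) (neg-mono-≤ (b≤ Sy))
  ... | s , upper , approx = - s , lower , approx⁻
    where
    open ≤-Reasoning poset
    lower : ∀ {x} → S x → - s ≤ x
    lower {x} Sx = begin
      - s    ≤⟨ neg-mono-≤ (upper (x , Sx , refl)) ⟩
      - - x  ≈⟨ AP.⁻¹-involutive x ⟩
      x      ∎
    approx⁻ : ∀ {y} → - s < y → ∃[ x ] S x × x < y
    approx⁻ {y} -s<y with approx -y<s
      where
      -y<s : - y < s
      -y<s = begin-strict
        - y    <⟨ neg-cancel-< -s<y ⟩
        - - s  ≈⟨ AP.⁻¹-involutive s ⟩
        s      ∎
    ... | z , (x , Sx , z≈-x) , -y<z = x , Sx , (begin-strict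
      x      ≈⟨ AP.⁻¹-involutive x ⟨
      - - x  ≈⟨ -‿cong z≈-x ⟨
      - z    <⟨ neg-cancel-< -y<z ⟩
      - - y  ≈⟨ AP.⁻¹-involutive y ⟩
      y      ∎)

  infimum-greatest : ∀ {S r y} → IsInfimum S r → (∀ {x} → S x → y ≤ x) → y ≤ r
  infimum-greatest {r = r} {y} (_ , approx) y≤ with y ≤? r
  ... | yes y≤r = y≤r
  ... | no  y≰r with approx (≰⇒> y≰r)
  ... | x , Sx , x<y = ⊥-elim (<⇒≱ x<y (y≤ Sx))

HasCardinality : ∀ {a ℓ p} (A : Setoid a ℓ) → (Setoid.Carrier A → Set p) → ℕ → Set _
HasCardinality A S n =
  ∃[ f ] Injective {A = Fin n} _≡_ _≈_ f
       × (∀ i → S (f i))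
       × (∀ {x} → S x → ∃[ i ] x ≈ f i)
  where open Setoid A

-- A norm on an abelian group amounts to a translation-invariant metric:
-- the metric is dist below, and the norm is the distance to ε.
record NormedGroup {ℓ} (ℝ : CompleteOrderedField ℓ) : Set (suc ℓ) where
  private module ℝ = CompleteOrderedField ℝ
  field
    abelianGroup : AbelianGroup ℓ ℓ
  open AbelianGroup abelianGroup public
  field
    ‖_‖       : Carrier → ℝ.Carrier
    ‖‖-cong   : ∀ {x y} → x ≈ y → ‖ x ‖ ℝ.≈ ‖ y ‖
    ‖‖-nonneg : ∀ x → ℝ.0# ℝ.≤ ‖ x ‖
    ‖ε‖≈0     : ‖ ε ‖ ℝ.≈ ℝ.0#
    ‖x‖≈0⇒x≈ε : ∀ {x} → ‖ x ‖ ℝ.≈ ℝ.0# → x ≈ ε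
    ‖⁻¹‖      : ∀ x → ‖ x ⁻¹ ‖ ℝ.≈ ‖ x ‖
    ‖∙‖       : ∀ x y → ‖ x ∙ y ‖ ℝ.≤ ‖ x ‖ ℝ.+ ‖ y ‖

  dist : Carrier → Carrier → ℝ.Carrier
  dist x y = ‖ x - y ‖

module _ {ℓ} {ℝ : CompleteOrderedField ℓ} where

  private module ℝ = CompleteOrderedField ℝ

  record Subgroup (G : NormedGroup ℝ) : Set (suc ℓ) where
    open NormedGroup G
    field
      _∋_      : Carrier → Set ℓ
      ∋-resp   : ∀ {x y} → x ≈ y → _∋_ x → _∋_ y
      ∋-ε      : _∋_ ε
      ∋-∙      : ∀ {x y} → _∋_ x → _∋_ y → _∋_ (x ∙ y)
      ∋-⁻¹     : ∀ {x} → _∋_ x → _∋_ (x ⁻¹)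

  open Subgroup public using (_∋_)

  IsClosed : {G : NormedGroup ℝ} → Subgroup G → Set ℓ
  IsClosed {G} H = ∀ {x} → (∀ {e} → ℝ.0# ℝ.< e → ∃[ y ] H ∋ y × dist x y ℝ.< e) → H ∋ x
    where open NormedGroup G

  -- Quotient elements are represented by elements of G, identified when
  -- they differ by an element of H.
  module _ (G : NormedGroup ℝ) (H : Subgroup G) (closed : IsClosed H) where
    private
      module G where
        open NormedGroup G public
        open AbelianGroupProperties abelianGroup public
        open CommutativeSemigroupProperties commutativeSemigroup public using (interchange)
      module H = Subgroup H
      open G using (_∙_; _-_; _⁻¹; ε; ‖_‖)

    CosetDistance : G.Carrier → ℝ.Carrier → Set ℓ
    CosetDistance a r = ∃[ h ] H ∋ h × r ℝ.≈ ‖ a - h ‖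

    private
      CosetDistance-infimum : ∀ a → ∃ (ℝ.IsInfimum (CosetDistance a))
      CosetDistance-infimum a = ℝ.infimum (CosetDistance a)
        (‖ a - ε ‖ , ε , H.∋-ε , ℝ.refl)
        (ℝ.0# , λ (h , _ , r≈) → ℝ.≤-trans (G.‖‖-nonneg _) (ℝ.≤-reflexive (ℝ.sym r≈)))

    -- Abstract to stop the infimum unfolding; it is determined by
    -- quotientNorm-isInfimum.
    abstract
      quotientNorm : G.Carrier → ℝ.Carrier
      quotientNorm a = proj₁ (CosetDistance-infimum a)

      quotientNorm-isInfimum : ∀ a → ℝ.IsInfimum (CosetDistance a) (quotientNorm a)
      quotientNorm-isInfimum a = proj₂ (CosetDistance-infimum a)

    private
      lower : ∀ a {h} → H ∋ h → quotientNorm a ℝ.≤ ‖ a - h ‖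
      lower a {h} Hh = proj₁ (quotientNorm-isInfimum a) (h , Hh , ℝ.refl)

      greatest : ∀ a {r} → (∀ h → H ∋ h → r ℝ.≤ ‖ a - h ‖) → r ℝ.≤ quotientNorm a
      greatest a r≤ = ℝ.infimum-greatest (quotientNorm-isInfimum a)
        λ (h , Hh , x≈) → ℝ.≤-trans (r≤ h Hh) (ℝ.≤-reflexive (ℝ.sym x≈))

      _~_ : Rel G.Carrier ℓ
      x ~ y = H ∋ (x - y)

      ≈⇒~ : ∀ {x y} → x G.≈ y → x ~ y
      ≈⇒~ x≈y = H.∋-resp (G.sym (G.x≈y⇒x∙y⁻¹≈ε x≈y)) H.∋-ε

      ~-sym : ∀ {x y} → x ~ y → y ~ x
      ~-sym {x} {y} x~y = H.∋-resp (G.⁻¹-anti-homo-// x y) (H.∋-⁻¹ x~y)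

      ~-trans : ∀ {x y z} → x ~ y → y ~ z → x ~ z
      ~-trans {x} {y} {z} x~y y~z = H.∋-resp eq (H.∋-∙ x~y y~z)
        where
        open ≈-Reasoning G.setoid
        eq : (x - y) ∙ (y - z) G.≈ x - z
        eq = begin
          (x - y) ∙ (y - z)    ≈⟨ G.assoc (x - y) y (z ⁻¹) ⟨
          (x - y) ∙ y ∙ z ⁻¹    ≈⟨ G.∙-congʳ (G.//-rightDividesˡ y x) ⟩
          x - z                 ∎

      //-∙ : ∀ a b x y → (a ∙ b) - (x ∙ y) G.≈ (a - x) ∙ (b - y)
      //-∙ a b x y = G.trans (G.∙-congˡ (G.sym (G.⁻¹-∙-comm x y))) (G.interchange a b (x ⁻¹) (y ⁻¹))

      norm-mono : ∀ {a b} → a ~ b → quotientNorm a ℝ.≤ quotientNorm b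
      norm-mono {a} {b} a~b = greatest b λ h Hh →
        ℝ.≤-trans (lower a (H.∋-∙ Hh a~b)) (ℝ.≤-reflexive (G.‖‖-cong (eq h)))
        where
        open ≈-Reasoning G.setoid
        eq : ∀ h → a - (h ∙ (a - b)) G.≈ b - h
        eq h = begin
          a - (h ∙ (a - b))            ≈⟨ G.∙-congˡ (G.⁻¹-∙-comm h (a - b)) ⟨
          a ∙ (h ⁻¹ ∙ (a - b) ⁻¹)       ≈⟨ G.∙-congˡ (G.∙-congˡ (G.⁻¹-anti-homo-// a b)) ⟩
          a ∙ (h ⁻¹ ∙ (b - a))          ≈⟨ G.∙-congˡ (G.comm (h ⁻¹) (b - a)) ⟩
          a ∙ ((b - a) ∙ h ⁻¹)          ≈⟨ G.assoc a (b - a) (h ⁻¹) ⟨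
          a ∙ (b - a) - h              ≈⟨ G.∙-congʳ (G.comm a (b - a)) ⟩
          (b - a) ∙ a - h              ≈⟨ G.∙-congʳ (G.//-rightDividesˡ a b) ⟩
          b - h                         ∎

      norm-cong : ∀ {a b} → a ~ b → quotientNorm a ℝ.≈ quotientNorm b
      norm-cong a~b = ℝ.≤-antisym (norm-mono a~b) (norm-mono (~-sym a~b))

      norm-nonneg : ∀ a → ℝ.0# ℝ.≤ quotientNorm a
      norm-nonneg a = greatest a λ _ _ → G.‖‖-nonneg _

      norm-ε : quotientNorm ε ℝ.≈ ℝ.0#
      norm-ε = ℝ.≤-antisym
        (ℝ.≤-trans (lower ε H.∋-ε)
          (ℝ.≤-reflexive (ℝ.trans (G.‖‖-cong (G.inverseʳ ε)) G.‖ε‖≈0)))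
        (norm-nonneg ε)

      norm-definite : ∀ {a} → quotientNorm a ℝ.≈ ℝ.0# → a ~ ε
      norm-definite {a} Na≈0 = H.∋-resp (G.sym (G.trans (G.∙-congˡ G.ε⁻¹≈ε) (G.identityʳ a)))
        (closed approx)
        where
        approx : ∀ {e} → ℝ.0# ℝ.< e → ∃[ y ] H ∋ y × G.dist a y ℝ.< e
        approx {e} 0<e with proj₂ (quotientNorm-isInfimum a) Na<e
          where
          open ≤-Reasoning ℝ.poset
          Na<e : quotientNorm a ℝ.< e
          Na<e = begin-strict
            quotientNorm a  ≈⟨ Na≈0 ⟩
            ℝ.0#            <⟨ 0<e ⟩
            e               ∎
        ... | r , (h , Hh , r≈) , r<e = h , Hh , (begin-strict
          ‖ a - h ‖  ≈⟨ r≈ ⟨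
          r           <⟨ r<e ⟩
          e           ∎)
          where open ≤-Reasoning ℝ.poset

      norm-⁻¹-≤ : ∀ a → quotientNorm (a ⁻¹) ℝ.≤ quotientNorm a
      norm-⁻¹-≤ a = greatest a λ h Hh → ℝ.≤-trans (lower (a ⁻¹) (H.∋-⁻¹ Hh))
        (ℝ.≤-reflexive (ℝ.trans (G.‖‖-cong (G.⁻¹-∙-comm a (h ⁻¹))) (G.‖⁻¹‖ (a - h))))

      norm-⁻¹ : ∀ a → quotientNorm (a ⁻¹) ℝ.≈ quotientNorm a
      norm-⁻¹ a = ℝ.≤-antisym (norm-⁻¹-≤ a)
        (ℝ.≤-trans (norm-mono (≈⇒~ (G.sym (G.⁻¹-involutive a)))) (norm-⁻¹-≤ (a ⁻¹)))

      norm-∙ : ∀ a b → quotientNorm (a ∙ b) ℝ.≤ quotientNorm a ℝ.+ quotientNorm b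
      norm-∙ a b = ℝ.x-z≤y⇒x≤y+z (greatest a λ h Hh → swap (ℝ.x-z≤y⇒x≤y+z (greatest b λ k Hk →
        swap (ℝ.≤-trans (ℝ.≤-trans (lower (a ∙ b) (H.∋-∙ Hh Hk))
          (ℝ.≤-reflexive (G.‖‖-cong (//-∙ a b h k)))) (G.‖∙‖ (a - h) (b - k))))))
        where
        swap : ∀ {x y z} → x ℝ.≤ y ℝ.+ z → x ℝ.- y ℝ.≤ z
        swap {x} {y} {z} le = begin
          x ℝ.- y                 ≤⟨ ℝ.+-monoˡ-≤ (ℝ.- y) le ⟩
          (y ℝ.+ z) ℝ.- y         ≈⟨ AbelianGroupProperties.xyx⁻¹≈y ℝ.+-abelianGroup y z ⟩
          z                       ∎
          where open ≤-Reasoning ℝ.poset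

    quotient : NormedGroup ℝ
    quotient = record
      { abelianGroup = record
        { Carrier = G.Carrier
        ; _≈_ = _~_
        ; _∙_ = _∙_
        ; ε = ε
        ; _⁻¹ = _⁻¹
        ; isAbelianGroup = record
          { isGroup = record
            { isMonoid = record
              { isSemigroup = record
                { isMagma = record
                  { isEquivalence = record
                    { refl = ≈⇒~ G.refl ; sym = ~-sym ; trans = ~-trans }
                  ; ∙-cong = λ {x} {y} {u} {v} x~y u~v →
                      H.∋-resp (G.sym (//-∙ x u y v)) (H.∋-∙ x~y u~v)
                  }
                ; assoc = λ x y z → ≈⇒~ (G.assoc x y z)
                }
              ; identity = (λ x → ≈⇒~ (G.identityˡ x)) , (λ x → ≈⇒~ (G.identityʳ x))
              }
            ; inverse = (λ x → ≈⇒~ (G.inverseˡ x)) , (λ x → ≈⇒~ (G.inverseʳ x))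
            ; ⁻¹-cong = λ {x} {y} x~y → H.∋-resp (G.sym (G.⁻¹-∙-comm x (y ⁻¹))) (H.∋-⁻¹ x~y)
            }
          ; comm = λ x y → ≈⇒~ (G.comm x y)
          }
        }
      ; ‖_‖ = quotientNorm
      ; ‖‖-cong = norm-cong
      ; ‖‖-nonneg = norm-nonneg
      ; ‖ε‖≈0 = norm-ε
      ; ‖x‖≈0⇒x≈ε = norm-definite
      ; ‖⁻¹‖ = norm-⁻¹
      ; ‖∙‖ = norm-∙
      }

  subgroup : (G : NormedGroup ℝ) → Subgroup G → NormedGroup ℝ
  subgroup G H = record
    { abelianGroup = record
      { Carrier = Σ G.Carrier H._∋_
      ; _≈_ = λ x y → proj₁ x G.≈ proj₁ y
      ; _∙_ = λ (x , Hx) (y , Hy) → x G.∙ y , H.∋-∙ Hx Hy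
      ; ε = G.ε , H.∋-ε
      ; _⁻¹ = λ (x , Hx) → x G.⁻¹ , H.∋-⁻¹ Hx
      ; isAbelianGroup = record
        { isGroup = record
          { isMonoid = record
            { isSemigroup = record
              { isMagma = record
                { isEquivalence = record { refl = G.refl ; sym = G.sym ; trans = G.trans }
                ; ∙-cong = G.∙-cong
                }
              ; assoc = λ x y z → G.assoc (proj₁ x) (proj₁ y) (proj₁ z)
              }
            ; identity = (λ x → G.identityˡ (proj₁ x)) , (λ x → G.identityʳ (proj₁ x))
            }
          ; inverse = (λ x → G.inverseˡ (proj₁ x)) , (λ x → G.inverseʳ (proj₁ x))
          ; ⁻¹-cong = G.⁻¹-cong
          }
        ; comm = λ x y → G.comm (proj₁ x) (proj₁ y)
        }
      }
    ; ‖_‖ = λ x → G.‖ proj₁ x ‖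
    ; ‖‖-cong = G.‖‖-cong
    ; ‖‖-nonneg = λ x → G.‖‖-nonneg (proj₁ x)
    ; ‖ε‖≈0 = G.‖ε‖≈0
    ; ‖x‖≈0⇒x≈ε = G.‖x‖≈0⇒x≈ε
    ; ‖⁻¹‖ = λ x → G.‖⁻¹‖ (proj₁ x)
    ; ‖∙‖ = λ x y → G.‖∙‖ (proj₁ x) (proj₁ y)
    }
    where
    module G = NormedGroup G
    module H = Subgroup H

  _×ᵐᵃˣ_ : NormedGroup ℝ → NormedGroup ℝ → NormedGroup ℝ
  G ×ᵐᵃˣ H = record
    { abelianGroup = DirectProduct.abelianGroup G.abelianGroup H.abelianGroup
    ; ‖_‖ = λ (v , u) → G.‖ v ‖ ℝ.⊔ H.‖ u ‖
    ; ‖‖-cong = λ (v≈ , u≈) → ℝ.⊔-cong (G.‖‖-cong v≈) (H.‖‖-cong u≈)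
    ; ‖‖-nonneg = λ (v , u) → ℝ.≤-trans (G.‖‖-nonneg v) (ℝ.x≤x⊔y _ _)
    ; ‖ε‖≈0 = ℝ.≤-antisym
        (ℝ.⊔-lub (ℝ.≤-reflexive G.‖ε‖≈0) (ℝ.≤-reflexive H.‖ε‖≈0))
        (ℝ.≤-trans (G.‖‖-nonneg G.ε) (ℝ.x≤x⊔y _ _))
    ; ‖x‖≈0⇒x≈ε = λ {(v , u)} ≈0 →
          G.‖x‖≈0⇒x≈ε (ℝ.≤-antisym (ℝ.≤-trans (ℝ.x≤x⊔y _ _) (ℝ.≤-reflexive ≈0)) (G.‖‖-nonneg v))
        , H.‖x‖≈0⇒x≈ε (ℝ.≤-antisym (ℝ.≤-trans (ℝ.x≤y⊔x _ _) (ℝ.≤-reflexive ≈0)) (H.‖‖-nonneg u))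
    ; ‖⁻¹‖ = λ (v , u) → ℝ.⊔-cong (G.‖⁻¹‖ v) (H.‖⁻¹‖ u)
    ; ‖∙‖ = λ (v , u) (v′ , u′) → ℝ.⊔-lub
        (ℝ.≤-trans (G.‖∙‖ v v′) (ℝ.+-mono-≤ (ℝ.x≤x⊔y _ _) (ℝ.x≤x⊔y _ _)))
        (ℝ.≤-trans (H.‖∙‖ u u′) (ℝ.+-mono-≤ (ℝ.x≤y⊔x _ _) (ℝ.x≤y⊔x _ _)))
    }
    where
    module G = NormedGroup G
    module H = NormedGroup H

  -- The definition of the packing number of a normed space involves only
  -- its additive group and its norm, and is stated at that level.
  module _ (Y : NormedGroup ℝ) where
    open NormedGroup Y

    IsPacking : (Carrier → Set ℓ) → Set ℓ
    IsPacking S = (∀ {v} → S v → ‖ v ‖ ℝ.< ℝ.1#)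
                × (∀ {v w} → S v → S w → ¬ v ≈ w → ℝ.1# ℝ.≤ ‖ v - w ‖)

    IsPackingNumber : ℕ → Set (suc ℓ)
    IsPackingNumber P =
        (∃[ S ] IsPacking S × HasCardinality setoid S P)
      × (∀ {S n} → IsPacking S → HasCardinality setoid S n → n ℕ.≤ P)

  module _ (X : NormedGroup ℝ) where
    open NormedGroup X
    open RawMonoidDefinitions rawMonoid using () renaming (_×_ to _·_)

    Orbit : ℕ → Carrier → Carrier → Set ℓ
    Orbit N α x = ∃[ n ] n ℕ.< N × x ≈ n · α

    IsNearestDistance : ℕ → Carrier → Carrier → ℝ.Carrier → Set ℓ
    IsNearestDistance N α x =
      ℝ.IsMinimum λ r → ∃[ y ] Orbit N α y × ¬ y ≈ x × r ℝ.≈ dist x y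

    -- If the orbit is a single point, the set whose minimum is taken is
    -- empty, there are no nearest-neighbour distances, and the count is 0.
    NearestDistances : ℕ → Carrier → ℝ.Carrier → Set ℓ
    NearestDistances N α r = ∃[ x ] Orbit N α x × IsNearestDistance N α x r

    IsDistanceCount : ℕ → Carrier → ℕ → Set ℓ
    IsDistanceCount N α = HasCardinality ℝ.setoid (NearestDistances N α)

record UltrametricGroup {ℓ} (ℝ : CompleteOrderedField ℓ) : Set (suc ℓ) where
  private module ℝ = CompleteOrderedField ℝ
  field
    abelianGroup : AbelianGroup ℓ ℓ
  open AbelianGroup abelianGroup public
  field
    d                    : Carrier → Carrier → ℝ.Carrier
    isUltrametric        : IsGeneralMetric _≈_ ℝ._≈_ ℝ._≤_ ℝ.0# ℝ._⊔_ d
    translationInvariant : TranslationInvariant ℝ._≈_ _∙_ d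

  private
    module d = IsGeneralMetric isUltrametric
    open AbelianGroupProperties abelianGroup

    d-⁻¹ : ∀ x → d (x ⁻¹) ε ℝ.≈ d x ε
    d-⁻¹ x = begin
      d (x ⁻¹) ε              ≈⟨ translationInvariant ⟨
      d (x ⁻¹ ∙ x) (ε ∙ x)    ≈⟨ d.cong (inverseˡ x) (identityˡ x) ⟩
      d ε x                   ≈⟨ d.sym ε x ⟩
      d x ε                   ∎
      where open ≈-Reasoning ℝ.setoid

    d-∙ : ∀ x y → d (x ∙ y) ε ℝ.≤ d x ε ℝ.+ d y ε
    d-∙ x y = begin
      d (x ∙ y) ε                       ≤⟨ d.triangle (x ∙ y) y ε ⟩
      d (x ∙ y) y ℝ.⊔ d y ε             ≈⟨ ℝ.⊔-cong (d.cong refl (sym (identityˡ y))) ℝ.refl ⟩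
      d (x ∙ y) (ε ∙ y) ℝ.⊔ d y ε       ≈⟨ ℝ.⊔-cong translationInvariant ℝ.refl ⟩
      d x ε ℝ.⊔ d y ε                   ≤⟨ ℝ.⊔-lub
                                            (≤-+ d.nonNegative)
                                            (ℝ.≤-trans (≤-+ d.nonNegative) (ℝ.≤-reflexive (ℝ.+-comm _ _))) ⟩
      d x ε ℝ.+ d y ε                   ∎
      where
      open ≤-Reasoning ℝ.poset
      ≤-+ : ∀ {a b} → ℝ.0# ℝ.≤ b → a ℝ.≤ a ℝ.+ b
      ≤-+ {a} 0≤b = ℝ.≤-trans (ℝ.≤-reflexive (ℝ.sym (ℝ.+-identityʳ a))) (ℝ.+-mono-≤ ℝ.≤-refl 0≤b)

  normedGroup : NormedGroup ℝ
  normedGroup = record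
    { abelianGroup = abelianGroup
    ; ‖_‖ = λ u → d u ε
    ; ‖‖-cong = λ x≈y → d.cong x≈y refl
    ; ‖‖-nonneg = λ _ → d.nonNegative
    ; ‖ε‖≈0 = d.≈⇒0 refl
    ; ‖x‖≈0⇒x≈ε = d.0⇒≈
    ; ‖⁻¹‖ = d-⁻¹
    ; ‖∙‖ = d-∙
    }

record NormedSpace {ℓ} (ℝ : CompleteOrderedField ℓ) : Set (suc ℓ) where
  private module ℝ = CompleteOrderedField ℝ
  field
    leftModule : LeftModule ℝ.ring ℓ ℓ
  open LeftModule leftModule public
  field
    ‖_‖         : Carrierᴹ → ℝ.Carrier
    ‖‖-cong     : ∀ {v w} → v ≈ᴹ w → ‖ v ‖ ℝ.≈ ‖ w ‖
    ‖‖-nonneg   : ∀ v → ℝ.0# ℝ.≤ ‖ v ‖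
    ‖v‖≈0⇒v≈0   : ∀ {v} → ‖ v ‖ ℝ.≈ ℝ.0# → v ≈ᴹ 0ᴹ
    homogeneous : ∀ t v → ‖ t *ₗ v ‖ ℝ.≈ ℝ.∣ t ∣ ℝ.* ‖ v ‖
    triangle    : ∀ v w → ‖ v +ᴹ w ‖ ℝ.≤ ‖ v ‖ ℝ.+ ‖ w ‖

  _-ᴹ_ : Carrierᴹ → Carrierᴹ → Carrierᴹ
  v -ᴹ w = v +ᴹ (-ᴹ w)

  private
    module V = AbelianGroupProperties +ᴹ-abelianGroup

  -1*v≈-v : ∀ v → (ℝ.- ℝ.1#) *ₗ v ≈ᴹ -ᴹ v
  -1*v≈-v v = V.inverseˡ-unique _ _ (begin
    (ℝ.- ℝ.1#) *ₗ v +ᴹ v               ≈⟨ +ᴹ-cong ≈ᴹ-refl (≈ᴹ-sym (*ₗ-identityˡ v)) ⟩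
    (ℝ.- ℝ.1#) *ₗ v +ᴹ ℝ.1# *ₗ v       ≈⟨ ≈ᴹ-sym (*ₗ-distribʳ v _ _) ⟩
    (ℝ.- ℝ.1# ℝ.+ ℝ.1#) *ₗ v           ≈⟨ *ₗ-cong (ℝ.-‿inverseˡ ℝ.1#) ≈ᴹ-refl ⟩
    ℝ.0# *ₗ v                          ≈⟨ *ₗ-zeroˡ v ⟩
    0ᴹ                                 ∎)
    where open ≈-Reasoning ≈ᴹ-setoid

  *ₗ-distrib-- : ∀ t v w → t *ₗ (v -ᴹ w) ≈ᴹ (t *ₗ v) -ᴹ (t *ₗ w)
  *ₗ-distrib-- t v w = begin
    t *ₗ (v -ᴹ w)               ≈⟨ *ₗ-distribˡ t v (-ᴹ w) ⟩
    t *ₗ v +ᴹ t *ₗ (-ᴹ w)       ≈⟨ +ᴹ-cong ≈ᴹ-refl (V.inverseˡ-unique _ _ (begin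
      t *ₗ (-ᴹ w) +ᴹ t *ₗ w       ≈⟨ *ₗ-distribˡ t (-ᴹ w) w ⟨
      t *ₗ (-ᴹ w +ᴹ w)            ≈⟨ *ₗ-cong ℝ.refl (-ᴹ‿inverseˡ w) ⟩
      t *ₗ 0ᴹ                     ≈⟨ *ₗ-zeroʳ t ⟩
      0ᴹ                          ∎)) ⟩
    (t *ₗ v) -ᴹ (t *ₗ w)        ∎
    where open ≈-Reasoning ≈ᴹ-setoid

  normedGroup : NormedGroup ℝ
  normedGroup = record
    { abelianGroup = +ᴹ-abelianGroup
    ; ‖_‖ = ‖_‖
    ; ‖‖-cong = ‖‖-cong
    ; ‖‖-nonneg = ‖‖-nonneg
    ; ‖ε‖≈0 = ‖0‖≈0
    ; ‖x‖≈0⇒x≈ε = ‖v‖≈0⇒v≈0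
    ; ‖⁻¹‖ = ‖-v‖≈‖v‖
    ; ‖∙‖ = triangle
    }
    where
    open ≈-Reasoning ℝ.setoid
    ∣0∣≈0 : ℝ.∣ ℝ.0# ∣ ℝ.≈ ℝ.0#
    ∣0∣≈0 = ℝ.≤-antisym
      (ℝ.⊔-lub ℝ.≤-refl (ℝ.≤-reflexive (AbelianGroupProperties.ε⁻¹≈ε ℝ.+-abelianGroup)))
      (ℝ.∣x∣-nonneg ℝ.0#)
    ‖0‖≈0 : ‖ 0ᴹ ‖ ℝ.≈ ℝ.0#
    ‖0‖≈0 = begin
      ‖ 0ᴹ ‖                    ≈⟨ ‖‖-cong (*ₗ-zeroˡ 0ᴹ) ⟨
      ‖ ℝ.0# *ₗ 0ᴹ ‖            ≈⟨ homogeneous ℝ.0# 0ᴹ ⟩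
      ℝ.∣ ℝ.0# ∣ ℝ.* ‖ 0ᴹ ‖     ≈⟨ ℝ.*-congʳ ∣0∣≈0 ⟩
      ℝ.0# ℝ.* ‖ 0ᴹ ‖           ≈⟨ ℝ.zeroˡ _ ⟩
      ℝ.0#                      ∎
    ‖-v‖≈‖v‖ : ∀ v → ‖ -ᴹ v ‖ ℝ.≈ ‖ v ‖
    ‖-v‖≈‖v‖ v = begin
      ‖ -ᴹ v ‖                        ≈⟨ ‖‖-cong (-1*v≈-v v) ⟨
      ‖ (ℝ.- ℝ.1#) *ₗ v ‖             ≈⟨ homogeneous (ℝ.- ℝ.1#) v ⟩
      ℝ.∣ ℝ.- ℝ.1# ∣ ℝ.* ‖ v ‖        ≈⟨ ℝ.*-congʳ ℝ.∣-1∣≈1 ⟩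
      ℝ.1# ℝ.* ‖ v ‖                  ≈⟨ ℝ.*-identityˡ _ ⟩
      ‖ v ‖                           ∎

module _ {ℓ} {ℝ : CompleteOrderedField ℓ} (V : NormedSpace ℝ) where

  private
    module ℝ = CompleteOrderedField ℝ
    module V = NormedSpace V
  open NormedSpace V using (_≈ᴹ_; _+ᴹ_; _-ᴹ_; -ᴹ_; 0ᴹ; _*ₗ_; ‖_‖) renaming (Carrierᴹ to ∣V∣)
  open RawMonoidDefinitions (NormedSpace.+ᴹ-rawMonoid V) using (sum)

  combination : ∀ {n} → (Fin n → ℝ.Carrier) → (Fin n → ∣V∣) → ∣V∣
  combination c b = sum λ i → c i *ₗ b i

  IsBasis : ∀ {n} → (Fin n → ∣V∣) → Set ℓ
  IsBasis b = (∀ c → combination c b ≈ᴹ 0ᴹ → ∀ i → c i ℝ.≈ ℝ.0#)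
            × (∀ v → ∃[ c ] v ≈ᴹ combination c b)

  HasDimension : ℕ → Set ℓ
  HasDimension n = ∃[ b ] IsBasis {n} b

  data Span (S : ∣V∣ → Set ℓ) : ∣V∣ → Set ℓ where
    generator : ∀ {v} → S v → Span S v
    zero      : Span S 0ᴹ
    _+ˢ_      : ∀ {v w} → Span S v → Span S w → Span S (v +ᴹ w)
    _*ˢ_      : ∀ t {v} → Span S v → Span S (t *ₗ v)
    respects  : ∀ {v w} → v ≈ᴹ w → Span S v → Span S w

  span : (∣V∣ → Set ℓ) → Subgroup V.normedGroup
  span S = record
    { _∋_ = Span S
    ; ∋-resp = respects
    ; ∋-ε = zero
    ; ∋-∙ = _+ˢ_
    ; ∋-⁻¹ = λ {v} Sv → respects (V.-1*v≈-v v) ((ℝ.- ℝ.1#) *ˢ Sv)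
    }

  record InnerProduct : Set ℓ where
    field
      ⟨_,_⟩       : ∣V∣ → ∣V∣ → ℝ.Carrier
      ⟨⟩-cong     : ∀ {v v′ w w′} → v ≈ᴹ v′ → w ≈ᴹ w′ → ⟨ v , w ⟩ ℝ.≈ ⟨ v′ , w′ ⟩
      ⟨⟩-sym      : ∀ v w → ⟨ v , w ⟩ ℝ.≈ ⟨ w , v ⟩
      ⟨⟩-+        : ∀ u v w → ⟨ u +ᴹ v , w ⟩ ℝ.≈ ⟨ u , w ⟩ ℝ.+ ⟨ v , w ⟩
      ⟨⟩-*        : ∀ t v w → ⟨ t *ₗ v , w ⟩ ℝ.≈ t ℝ.* ⟨ v , w ⟩
      ⟨⟩-nonneg   : ∀ v → ℝ.0# ℝ.≤ ⟨ v , v ⟩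
      ⟨⟩-definite : ∀ {v} → ⟨ v , v ⟩ ℝ.≈ ℝ.0# → v ≈ᴹ 0ᴹ
      induces     : ∀ v → ‖ v ‖ ℝ.* ‖ v ‖ ℝ.≈ ⟨ v , v ⟩

module _ {ℓ} {ℝ : CompleteOrderedField ℓ}
         (V : NormedSpace ℝ) (U : UltrametricGroup ℝ) where

  private
    module ℝ = CompleteOrderedField ℝ
    module V = NormedSpace V
    module U where
      open UltrametricGroup U public
      open NormedGroup normedGroup public using (‖_‖; ‖‖-cong; ‖ε‖≈0)
      open AbelianGroupProperties abelianGroup public using (ε⁻¹≈ε)

  ambient : NormedGroup ℝ
  ambient = V.normedGroup ×ᵐᵃˣ U.normedGroup

  module _ (Λ : Subgroup ambient) where

    private module Λ = Subgroup Λ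

    W : Subgroup V.normedGroup
    W = record
      { _∋_ = λ v → ∀ t → Λ ∋ (t V.*ₗ v , U.ε)
      ; ∋-resp = λ v≈w Wv t → Λ.∋-resp (V.*ₗ-cong ℝ.refl v≈w , U.refl) (Wv t)
      ; ∋-ε = λ t → Λ.∋-resp (V.≈ᴹ-sym (V.*ₗ-zeroʳ t) , U.refl) Λ.∋-ε
      ; ∋-∙ = λ {v} {w} Wv Ww t → Λ.∋-resp
          (V.≈ᴹ-sym (V.*ₗ-distribˡ t v w) , U.identityˡ U.ε)
          (Λ.∋-∙ (Wv t) (Ww t))
      ; ∋-⁻¹ = λ {v} Wv t → Λ.∋-resp
          (V.≈ᴹ-trans (V.*ₗ-assoc t (ℝ.- ℝ.1#) v) (V.*ₗ-cong ℝ.refl (V.-1*v≈-v v)) , U.refl)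
          (Wv (t ℝ.* ℝ.- ℝ.1#))
      }

    module _ (Λ-closed : IsClosed Λ) where

      X : NormedGroup ℝ
      X = quotient ambient Λ Λ-closed

      W-closed : IsClosed W
      W-closed {v} v-adherent t = Λ-closed tv-adherent
        where
        module A = NormedGroup ambient
        open ≤-Reasoning ℝ.poset
        c : ℝ.Carrier
        c = ℝ.∣ t ∣ ℝ.+ ℝ.1#
        0≤c : ℝ.0# ℝ.≤ c
        0≤c = begin
          ℝ.0#           ≈⟨ ℝ.+-identityʳ ℝ.0# ⟨
          ℝ.0# ℝ.+ ℝ.0#  ≤⟨ ℝ.+-mono-≤ (ℝ.∣x∣-nonneg t) ℝ.0≤1 ⟩
          c              ∎
        ∣t∣≤c : ℝ.∣ t ∣ ℝ.≤ c
        ∣t∣≤c = begin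
          ℝ.∣ t ∣           ≈⟨ ℝ.+-identityʳ _ ⟨
          ℝ.∣ t ∣ ℝ.+ ℝ.0#  ≤⟨ ℝ.+-mono-≤ ℝ.≤-refl ℝ.0≤1 ⟩
          c                 ∎
        c≉0 : ¬ c ℝ.≈ ℝ.0#
        c≉0 c≈0 = ℝ.0≉1 (ℝ.≤-antisym ℝ.0≤1 (begin
          ℝ.1#              ≈⟨ ℝ.+-identityˡ _ ⟨
          ℝ.0# ℝ.+ ℝ.1#     ≤⟨ ℝ.+-mono-≤ (ℝ.∣x∣-nonneg t) ℝ.≤-refl ⟩
          c                 ≈⟨ c≈0 ⟩
          ℝ.0#              ∎))
        c⁻¹ : ℝ.Carrier
        c⁻¹ = proj₁ (ℝ.inverse c c≉0)
        cc⁻¹≈1 : c ℝ.* c⁻¹ ℝ.≈ ℝ.1#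
        cc⁻¹≈1 = proj₂ (ℝ.inverse c c≉0)
        ec⁻¹c≈e : ∀ e → (e ℝ.* c⁻¹) ℝ.* c ℝ.≈ e
        ec⁻¹c≈e e = ℝ.trans (ℝ.*-assoc e c⁻¹ c)
          (ℝ.trans (ℝ.*-congˡ (ℝ.trans (ℝ.*-comm c⁻¹ c) cc⁻¹≈1)) (ℝ.*-identityʳ e))
        ec⁻¹>0 : ∀ {e} → ℝ.0# ℝ.< e → ℝ.0# ℝ.< e ℝ.* c⁻¹
        ec⁻¹>0 {e} 0<e = ℝ.≰⇒> λ ec⁻¹≤0 → ℝ.<⇒≱ 0<e (begin
          e                    ≈⟨ ec⁻¹c≈e e ⟨
          (e ℝ.* c⁻¹) ℝ.* c    ≤⟨ ℝ.*-monoʳ-≤ 0≤c ec⁻¹≤0 ⟩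
          ℝ.0# ℝ.* c           ≈⟨ ℝ.zeroˡ c ⟩
          ℝ.0#                 ∎)
        tv-adherent : ∀ {e} → ℝ.0# ℝ.< e →
                      ∃[ y ] Λ ∋ y × A.dist (t V.*ₗ v , U.ε) y ℝ.< e
        tv-adherent {e} 0<e with v-adherent (ec⁻¹>0 0<e)
        ... | w , Ww , v-w<ec⁻¹ = (t V.*ₗ w , U.ε) , Ww t ,
          ℝ.≰⇒> λ e≤dist → ℝ.<⇒≱ v-w<ec⁻¹ (begin
            e ℝ.* c⁻¹                            ≤⟨ ℝ.*-monoʳ-≤ c⁻¹≥0 (ℝ.≤-trans e≤dist dist≤) ⟩
            (r ℝ.* c) ℝ.* c⁻¹                    ≈⟨ ℝ.*-assoc r c c⁻¹ ⟩
            r ℝ.* (c ℝ.* c⁻¹)                    ≈⟨ ℝ.*-congˡ cc⁻¹≈1 ⟩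
            r ℝ.* ℝ.1#                           ≈⟨ ℝ.*-identityʳ r ⟩
            r                                    ∎)
          where
          r : ℝ.Carrier
          r = V.‖ v V.-ᴹ w ‖
          c⁻¹≥0 : ℝ.0# ℝ.≤ c⁻¹
          c⁻¹≥0 = begin
            ℝ.0#            ≤⟨ proj₁ (ec⁻¹>0 (ℝ.0≤1 , ℝ.0≉1)) ⟩
            ℝ.1# ℝ.* c⁻¹    ≈⟨ ℝ.*-identityˡ c⁻¹ ⟩
            c⁻¹             ∎
          dist≤ : A.dist (t V.*ₗ v , U.ε) (t V.*ₗ w , U.ε) ℝ.≤ r ℝ.* c
          dist≤ = ℝ.⊔-lub
            (begin
              V.‖ (t V.*ₗ v) V.-ᴹ (t V.*ₗ w) ‖   ≈⟨ V.‖‖-cong (V.*ₗ-distrib-- t v w) ⟨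
              V.‖ t V.*ₗ (v V.-ᴹ w) ‖            ≈⟨ V.homogeneous t _ ⟩
              ℝ.∣ t ∣ ℝ.* r                      ≤⟨ ℝ.*-monoʳ-≤ (V.‖‖-nonneg _) ∣t∣≤c ⟩
              c ℝ.* r                            ≈⟨ ℝ.*-comm c r ⟩
              r ℝ.* c                            ∎)
            (begin
              U.‖ U.ε U.- U.ε ‖   ≈⟨ U.‖‖-cong (U.inverseʳ U.ε) ⟩
              U.‖ U.ε ‖            ≈⟨ U.‖ε‖≈0 ⟩
              ℝ.0#                 ≤⟨ ℝ.*-nonneg (V.‖‖-nonneg _) 0≤c ⟩
              r ℝ.* c              ∎)

      reducedFactor : NormedGroup ℝ
      reducedFactor = quotient V.normedGroup W W-closed

    module _ (ip : InnerProduct V) where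
      open InnerProduct ip

      W⊥ : V.Carrierᴹ → Set ℓ
      W⊥ p = ∀ {w} → W ∋ w → ⟨ p , w ⟩ ℝ.≈ ℝ.0#

      -- The orthogonal projection to W⊥ as a relation: v = p + w, p ∈ W⊥, w ∈ W.
      IsProjection : V.Carrierᴹ → V.Carrierᴹ → Set ℓ
      IsProjection v p = W⊥ p × W ∋ (v V.-ᴹ p)

      effectiveFactor : NormedGroup ℝ
      effectiveFactor = subgroup V.normedGroup
        (span V λ p → ∃[ v ] ∃[ u ] Λ ∋ (v , u) × IsProjection v p)

-- With n = N - 1, the nearest-neighbour distance of j α in the orbit is D (j ⊔ (n ∸ j)),
-- where D k is the least nonzero ‖ m α ‖ with 1 ≤ m ≤ k.  So the distances are the
-- values of D on [K, n], K = ⌈ n /2⌉: the value δ = D K, and one for each record time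
-- m₁ < … < mᵣ in (K, n].  Distinct record times differ by at most K, hence
-- ‖ mᵢ α ‖ < δ ≤ ‖ mᵢ α - mⱼ α ‖.  Lift the mᵢ α to vectors of norm < δ; by the
-- ultrametric inequality the differences of the U-components also have norm < δ, so the
-- V-components are separated by δ, even modulo W, and r ≤ P(V/W).
--
-- In the inner-product case, project the V-components to W⊥ and split off E_Λ.  The
-- component of a lift of m α orthogonal to E_Λ is m f for a fixed f.  As every mᵢ ≥ K
-- and mᵢ - mⱼ is at most K in absolute value, by Pythagoras the E_Λ-components eᵢ satisfy
-- ‖ eᵢ ‖² < δ² - ‖ K f ‖² ≤ ‖ eⱼ - eₖ ‖², so that r ≤ P(E_Λ).
module Submission where

open import Defs
open import Algebra.Bundles using (AbelianGroup)
import Algebra.Properties.AbelianGroup as AbelianGroupProperties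
import Algebra.Properties.CommutativeMonoid.Mult as Mult
import Algebra.Properties.CommutativeSemigroup as CommutativeSemigroupProperties
import Algebra.Properties.Ring as RingProperties
open import Data.Empty using (⊥-elim)
open import Data.Fin.Base using (Fin; zero; suc)
import Data.Fin.Properties as Fin
open import Data.List.Base using (List; []; _∷_; tabulate)
open import Data.Nat.Base as ℕ using (ℕ; zero; suc; _+_; _≤_; z≤n; s≤s; ⌈_/2⌉)
import Data.Nat.Properties as ℕ
open import Data.Product.Base using (∃; ∃-syntax; _×_; _,_; proj₁; proj₂)
open import Data.Sum.Base using (_⊎_; inj₁; inj₂)
open import Function.Metric.Structures using (IsGeneralMetric)
open import Level using (Level)
open import Relation.Binary.PropositionalEquality.Core using (_≡_; refl; cong; subst)
  renaming (trans to ≡-trans)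
import Relation.Binary.Reasoning.PartialOrder as ≤-Reasoning
import Relation.Binary.Reasoning.Setoid as ≈-Reasoning
open import Relation.Nullary using (¬_; Dec; yes; no)

-- Identities in abelian groups.

module AbelianGroupLemmas {c ℓ : Level} (G : AbelianGroup c ℓ) where
  open AbelianGroup G public
  open AbelianGroupProperties G public
  open CommutativeSemigroupProperties commutativeSemigroup public using (interchange; x∙yz≈y∙xz)
  open Mult commutativeMonoid public
    using (×-distrib-+)
    renaming (_×_ to _·_)
  open ≈-Reasoning setoid

  //-∙-distrib : ∀ a b x y → (a ∙ b) - (x ∙ y) ≈ (a - x) ∙ (b - y)
  //-∙-distrib a b x y = trans (∙-congˡ (sym (⁻¹-∙-comm x y))) (interchange a b (x ⁻¹) (y ⁻¹))

  //-cancelˡ : ∀ a x y → (a ∙ x) - (a ∙ y) ≈ x - y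
  //-cancelˡ a x y = begin
    (a ∙ x) - (a ∙ y)    ≈⟨ //-∙-distrib a x a y ⟩
    (a - a) ∙ (x - y)    ≈⟨ ∙-congʳ (inverseʳ a) ⟩
    ε ∙ (x - y)          ≈⟨ identityˡ _ ⟩
    x - y                ∎

  x-[x-y]≈y : ∀ x y → x - (x - y) ≈ y
  x-[x-y]≈y x y = begin
    x - (x - y)    ≈⟨ ∙-congˡ (⁻¹-anti-homo-// x y) ⟩
    x ∙ (y - x)    ≈⟨ assoc x y (x ⁻¹) ⟨
    x ∙ y - x      ≈⟨ xyx⁻¹≈y x y ⟩
    y              ∎

  x-[y∙z]≈x-y-z : ∀ x y z → x - (y ∙ z) ≈ (x - y) - z
  x-[y∙z]≈x-y-z x y z = trans (∙-congˡ (sym (⁻¹-∙-comm y z))) (sym (assoc x (y ⁻¹) (z ⁻¹)))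

  x-[y-z]≈z-[y-x] : ∀ x y z → x - (y - z) ≈ z - (y - x)
  x-[y-z]≈z-[y-x] x y z = begin
    x - (y - z)    ≈⟨ ∙-congˡ (⁻¹-anti-homo-// y z) ⟩
    x ∙ (z - y)    ≈⟨ x∙yz≈y∙xz x z (y ⁻¹) ⟩
    z ∙ (x - y)    ≈⟨ ∙-congˡ (⁻¹-anti-homo-// y x) ⟨
    z - (y - x)    ∎

  [x-y]∙[y-z]≈x-z : ∀ x y z → (x - y) ∙ (y - z) ≈ x - z
  [x-y]∙[y-z]≈x-z x y z = trans (sym (assoc (x - y) y (z ⁻¹))) (∙-congʳ (//-rightDividesˡ y x))

  [x-y]-[z-y]≈x-z : ∀ x y z → (x - y) - (z - y) ≈ x - z
  [x-y]-[z-y]≈x-z x y z = trans (∙-congˡ (⁻¹-anti-homo-// z y)) ([x-y]∙[y-z]≈x-z x y z)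

  //-interchange : ∀ a b x y → (a - b) - (x - y) ≈ (a - x) - (b - y)
  //-interchange a b x y = trans (//-∙-distrib a (b ⁻¹) x (y ⁻¹)) (∙-congˡ (⁻¹-∙-comm b (y ⁻¹)))

  x-ε≈x : ∀ x → x - ε ≈ x
  x-ε≈x x = trans (∙-congˡ ε⁻¹≈ε) (identityʳ x)

  ·-distrib-⁻¹ : ∀ n x → n · (x ⁻¹) ≈ (n · x) ⁻¹
  ·-distrib-⁻¹ zero    x = sym ε⁻¹≈ε
  ·-distrib-⁻¹ (suc n) x = trans (∙-congˡ (·-distrib-⁻¹ n x)) (⁻¹-∙-comm x (n · x))

  ·-distrib-- : ∀ n x y → n · (x - y) ≈ n · x - n · y
  ·-distrib-- n x y = trans (×-distrib-+ x (y ⁻¹) n) (∙-congˡ (·-distrib-⁻¹ n y))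

-- Arithmetic of halves and index differences.

n≤⌈n/2⌉+⌈n/2⌉ : ∀ n → n ≤ ⌈ n /2⌉ + ⌈ n /2⌉
n≤⌈n/2⌉+⌈n/2⌉ n = subst (_≤ ⌈ n /2⌉ + ⌈ n /2⌉) (ℕ.⌊n/2⌋+⌈n/2⌉≡n n)
  (ℕ.+-monoˡ-≤ ⌈ n /2⌉ (ℕ.⌊n/2⌋≤⌈n/2⌉ n))

⌈n/2⌉+⌈n/2⌉≤1+n : ∀ n → ⌈ n /2⌉ + ⌈ n /2⌉ ≤ suc n
⌈n/2⌉+⌈n/2⌉≤1+n n = subst (⌈ n /2⌉ + ⌈ n /2⌉ ≤_) (ℕ.⌊n/2⌋+⌈n/2⌉≡n (suc n))
  (ℕ.+-monoʳ-≤ ⌈ n /2⌉ (ℕ.⌊n/2⌋≤⌈n/2⌉ (suc n)))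

-- If `j` is below `K = ⌈ n /2⌉`, then `K + j` is at most `2K - 1`, hence at most `n`, so `n ∸ j`
-- reaches `K`. Thus no nearest distance reads `D` before `K`.
⌈n/2⌉≤j⊔[n∸j] : ∀ n j → ⌈ n /2⌉ ≤ j ℕ.⊔ (n ℕ.∸ j)
⌈n/2⌉≤j⊔[n∸j] n j with ⌈ n /2⌉ ℕ.≤? j
... | yes K≤j = ℕ.≤-trans K≤j (ℕ.m≤m⊔n j _)
... | no  K≰j = ℕ.≤-trans (ℕ.m+n≤o⇒m≤o∸n ⌈ n /2⌉ K+j≤n) (ℕ.m≤n⊔m j _)
  where
  open ℕ.≤-Reasoning
  K+j≤n : ⌈ n /2⌉ + j ≤ n
  K+j≤n = ℕ.≤-pred (begin
    suc (⌈ n /2⌉ + j)       ≡⟨ ℕ.+-suc ⌈ n /2⌉ j ⟨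
    ⌈ n /2⌉ + suc j         ≤⟨ ℕ.+-monoʳ-≤ ⌈ n /2⌉ (ℕ.≰⇒> K≰j) ⟩
    ⌈ n /2⌉ + ⌈ n /2⌉       ≤⟨ ⌈n/2⌉+⌈n/2⌉≤1+n n ⟩
    suc n                   ∎)

∣i-j∣≤i⊔[n∸i] : ∀ {n} i j → j ≤ n → ℕ.∣ i - j ∣ ≤ i ℕ.⊔ (n ℕ.∸ i)
∣i-j∣≤i⊔[n∸i] i j j≤n with ℕ.≤-total j i
... | inj₁ j≤i = ℕ.≤-trans (ℕ.≤-reflexive (ℕ.m≤n⇒∣n-m∣≡n∸m j≤i))
  (ℕ.≤-trans (ℕ.m∸n≤m i j) (ℕ.m≤m⊔n i _))
... | inj₂ i≤j = ℕ.≤-trans (ℕ.≤-reflexive (ℕ.m≤n⇒∣m-n∣≡n∸m i≤j))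
  (ℕ.≤-trans (ℕ.∸-monoˡ-≤ i j≤n) (ℕ.m≤n⊔m i _))

∣i-j∣≤k : ∀ {i j k} → i ≤ j + k → j ≤ i + k → ℕ.∣ i - j ∣ ≤ k
∣i-j∣≤k {i} {j} {k} i≤j+k j≤i+k with ℕ.≤-total j i
... | inj₁ j≤i = ℕ.≤-trans (ℕ.≤-reflexive (ℕ.m≤n⇒∣n-m∣≡n∸m j≤i)) (ℕ.m≤n+o⇒m∸n≤o i j i≤j+k)
... | inj₂ i≤j = ℕ.≤-trans (ℕ.≤-reflexive (ℕ.m≤n⇒∣m-n∣≡n∸m i≤j)) (ℕ.m≤n+o⇒m∸n≤o j i j≤i+k)

-- Multiples of one element and their record minima.

module NormedGroupLemmas {ℓ : Level} {ℝ : CompleteOrderedField ℓ} (X : NormedGroup ℝ) where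
  private module ℝ = CompleteOrderedField ℝ
  open NormedGroup X public renaming (refl to ≈-refl)
  open AbelianGroupLemmas abelianGroup public
    using ( _·_; ·-distrib--; //-∙-distrib; //-interchange; //-cancelˡ; //-rightDividesˡ
          ; x-[x-y]≈y; x-[y∙z]≈x-y-z; x-[y-z]≈z-[y-x]; [x-y]-[z-y]≈x-z; x-ε≈x; xyx⁻¹≈y
          ; x∙y⁻¹≈ε⇒x≈y; x≈y⇒x∙y⁻¹≈ε; ⁻¹-anti-homo-// )

  -- Translation invariance: one copy of `x` is cancelled from both multiples until an index is
  -- zero.
  dist-· : ∀ i j x → dist (i · x) (j · x) ℝ.≈ ‖ ℕ.∣ i - j ∣ · x ‖
  dist-· zero    j       x = ℝ.trans (‖‖-cong (identityˡ _)) (‖⁻¹‖ (j · x))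
  dist-· (suc i) zero    x = ‖‖-cong (x-ε≈x _)
  dist-· (suc i) (suc j) x = ℝ.trans (‖‖-cong (//-cancelˡ x (i · x) (j · x))) (dist-· i j x)

module Records {ℓ : Level} {ℝ : CompleteOrderedField ℓ} (X : NormedGroup ℝ) (α : NormedGroup.Carrier X) where
  private module ℝ = CompleteOrderedField ℝ
  open NormedGroupLemmas X

  -- Zero multiples are excluded: they come from repeated points of the orbit, which are not
  -- neighbours of each other.
  Improves : ℕ → ℝ.Carrier → Set ℓ
  Improves m r = ‖ m · α ‖ ℝ.< r × ¬ m · α ≈ ε

  -- The outcome of the comparison is kept as a relation, so that arguments about `D` split on it
  -- rather than on `excludedMiddle`.
  Step : ℕ → ℝ.Carrier → ℝ.Carrier → Set ℓ
  Step m r s = (s ≡ r × ¬ Improves m r) ⊎ (s ≡ ‖ m · α ‖ × Improves m r)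

  step : ∀ m r → ∃ (Step m r)
  step m r with ℝ.excludedMiddle {Improves m r}
  ... | yes improves = ‖ m · α ‖ , inj₂ (refl , improves)
  ... | no  improves = r , inj₁ (refl , improves)

  -- The least of the nonzero ‖ m · α ‖ with 1 ≤ m ≤ k; the value at k = 0 is
  -- that at k = 1.
  D : ℕ → ℝ.Carrier
  D zero    = ‖ 1 · α ‖
  D (suc k) = proj₁ (step (suc k) (D k))

  D-step : ∀ k → Step (suc k) (D k) (D (suc k))
  D-step k = proj₂ (step (suc k) (D k))

  D-suc : ∀ k → D (suc k) ℝ.≤ D k
  D-suc k with D-step k
  ... | inj₁ (eq , _) = ℝ.≤-reflexive (ℝ.reflexive eq)
  ... | inj₂ (eq , (le , _) , _) = ℝ.≤-trans (ℝ.≤-reflexive (ℝ.reflexive eq)) le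

  D-antitone : ∀ {k l} → k ≤ l → D l ℝ.≤ D k
  D-antitone {k} {l} k≤l with ℕ.m≤n⇒m<n∨m≡n k≤l
  ... | inj₂ refl = ℝ.≤-refl
  D-antitone {k} {suc l} _ | inj₁ (s≤s k≤l) = ℝ.≤-trans (D-suc l) (D-antitone k≤l)

  D-lower : ∀ {m k} → m ≤ k → ¬ m · α ≈ ε → D k ℝ.≤ ‖ m · α ‖
  D-lower {zero}  {k} _ ≉ε = ⊥-elim (≉ε ≈-refl)
  D-lower {suc m} {suc k} (s≤s m≤k) ≉ε with ℕ.m≤n⇒m<n∨m≡n m≤k
  ... | inj₁ m<k = ℝ.≤-trans (D-suc k) (D-lower m<k ≉ε)
  ... | inj₂ refl with D-step k
  ... | inj₂ (eq , _) = ℝ.≤-reflexive (ℝ.reflexive eq)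
  ... | inj₁ (eq , ¬improves) with D k ℝ.≤? ‖ suc k · α ‖
  ... | yes le = ℝ.≤-trans (ℝ.≤-reflexive (ℝ.reflexive eq)) le
  ... | no ≰ = ⊥-elim (¬improves (ℝ.≰⇒> ≰ , ≉ε))

  -- Serves both as the lower bound on nearest distances and as the separation of the record
  -- multiples.
  D-≤-dist : ∀ i j {k} → ℕ.∣ i - j ∣ ≤ k → ¬ i · α ≈ j · α → D k ℝ.≤ dist (i · α) (j · α)
  D-≤-dist i j ≤k i≉j = ℝ.≤-trans
    (D-lower ≤k λ ≈ε → i≉j (x∙y⁻¹≈ε⇒x≈y _ _ (‖x‖≈0⇒x≈ε
      (ℝ.trans (dist-· i j α) (ℝ.trans (‖‖-cong ≈ε) ‖ε‖≈0)))))
    (ℝ.≤-reflexive (ℝ.sym (dist-· i j α)))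

  module _ (α≉ε : ¬ α ≈ ε) where

    -- The bound is `k ⊔ 1` because `D zero` borrows the value at `1`, which belongs to a nonzero
    -- multiple as `α` is nonzero.
    D-attained⊔1 : ∀ k → ∃[ m ] m ≤ k ℕ.⊔ 1 × ¬ m · α ≈ ε × D k ℝ.≈ ‖ m · α ‖
    D-attained⊔1 zero = 1 , ℕ.≤-refl , (λ ≈ε → α≉ε (trans (sym (identityʳ α)) ≈ε)) , ℝ.refl
    D-attained⊔1 (suc k) with D-step k
    ... | inj₂ (eq , _ , ≉ε) = suc k , ℕ.m≤m⊔n (suc k) 1 , ≉ε , ℝ.reflexive eq
    ... | inj₁ (eq , _) with D-attained⊔1 k
    ... | m , m≤ , ≉ε , D≈ =
      m , ℕ.≤-trans m≤ (ℕ.⊔-monoˡ-≤ 1 (ℕ.n≤1+n k)) , ≉ε , ℝ.trans (ℝ.reflexive eq) D≈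

    D-attained : ∀ {k} → 1 ≤ k → ∃[ m ] m ≤ k × ¬ m · α ≈ ε × D k ℝ.≈ ‖ m · α ‖
    D-attained {k} 1≤k with D-attained⊔1 k
    ... | m , m≤ , rest = m , subst (m ≤_) (ℕ.m≥n⇒m⊔n≡m 1≤k) m≤ , rest

    private
      -- Go down from `j` if the maximum is `j`, up if it is `n ∸ j`; either way the index stays
      -- between `0` and `n`.
      away : ∀ {n j m} → j ≤ n → m ≤ j ℕ.⊔ (n ℕ.∸ j) → ∃[ i ] i ≤ n × ℕ.∣ j - i ∣ ≡ m
      away {n} {j} {m} j≤n m≤ with ℕ.⊔-sel j (n ℕ.∸ j)
      ... | inj₁ eq = j ℕ.∸ m , ℕ.≤-trans (ℕ.m∸n≤m j m) j≤n ,
        ≡-trans (ℕ.m≤n⇒∣n-m∣≡n∸m (ℕ.m∸n≤m j m)) (ℕ.m∸[m∸n]≡n (subst (m ≤_) eq m≤))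
      ... | inj₂ eq = j + m ,
        subst (j + m ≤_) (ℕ.m+[n∸m]≡n j≤n) (ℕ.+-monoʳ-≤ j (subst (m ≤_) eq m≤)) ,
        ℕ.∣m-m+n∣≡n j m

    module _ {n : ℕ} (1≤n : 1 ≤ n) where

      1≤⌈n/2⌉ : 1 ≤ ⌈ n /2⌉
      1≤⌈n/2⌉ = ℕ.⌈n/2⌉-mono 1≤n

      -- Seen from `j`, the index differences to `0, …, n` are exactly those up to `j ⊔ (n ∸ j)`:
      -- `away` realises the one at which `D` is attained, and none is larger.
      nearest : ∀ {j} → j ≤ n → IsNearestDistance X (suc n) α (j · α) (D (j ℕ.⊔ (n ℕ.∸ j)))
      nearest {j} j≤n = attained , lower
        where
        attained : ∃[ y ] Orbit X (suc n) α y × ¬ y ≈ j · α ×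
                   D (j ℕ.⊔ (n ℕ.∸ j)) ℝ.≈ dist (j · α) y
        attained with D-attained (ℕ.≤-trans 1≤⌈n/2⌉ (⌈n/2⌉≤j⊔[n∸j] n j))
        ... | m , m≤ , ≉ε , D≈ with away j≤n m≤
        ... | i , i≤n , refl =
          i · α , (i , s≤s i≤n , ≈-refl) ,
          (λ i≈j → ≉ε (‖x‖≈0⇒x≈ε (ℝ.trans (ℝ.sym (dist-· j i α))
            (ℝ.trans (‖‖-cong (x≈y⇒x∙y⁻¹≈ε (sym i≈j))) ‖ε‖≈0)))) ,
          ℝ.trans D≈ (ℝ.sym (dist-· j i α))
        lower : ∀ {r} → ∃[ y ] Orbit X (suc n) α y × ¬ y ≈ j · α × r ℝ.≈ dist (j · α) y →
                D (j ℕ.⊔ (n ℕ.∸ j)) ℝ.≤ r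
        lower {r} (y , (i , s≤s i≤n , y≈) , y≉ , r≈) = begin
          D (j ℕ.⊔ (n ℕ.∸ j))       ≤⟨ D-≤-dist j i (∣i-j∣≤i⊔[n∸i] j i i≤n) (λ j≈i → y≉ (trans y≈ (sym j≈i))) ⟩
          dist (j · α) (i · α)      ≈⟨ ‖‖-cong (∙-congˡ (⁻¹-cong y≈)) ⟨
          dist (j · α) y            ≈⟨ r≈ ⟨
          r                         ∎
          where open ≤-Reasoning ℝ.poset

      nearestDistance⇒D : ∀ {r} → NearestDistances X (suc n) α r →
                          ∃[ k ] ⌈ n /2⌉ ≤ k × k ≤ n × r ℝ.≈ D k
      nearestDistance⇒D {r} (x , (j , s≤s j≤n , x≈) , (y , Oy , y≉x , r≈) , r≤) =
        j ℕ.⊔ (n ℕ.∸ j) , ⌈n/2⌉≤j⊔[n∸j] n j , ℕ.⊔-lub j≤n (ℕ.m∸n≤m n j) ,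
        -- Minima are unique: after replacing `x` by `j · α`, each value bounds from below the
        -- distances among which the other is attained.
        ℝ.≤-antisym (r≤-D (proj₁ (nearest j≤n)))
          (proj₂ (nearest j≤n) (y , Oy , (λ y≈ → y≉x (trans y≈ (sym x≈))) ,
            ℝ.trans r≈ (‖‖-cong (∙-congʳ x≈))))
        where
        r≤-D : ∀ {s} → ∃[ z ] Orbit X (suc n) α z × ¬ z ≈ j · α × s ℝ.≈ dist (j · α) z → r ℝ.≤ s
        r≤-D (z , Oz , z≉ , s≈) = r≤ (z , Oz , (λ z≈x → z≉ (trans z≈x x≈)) ,
          ℝ.trans s≈ (‖‖-cong (∙-congʳ (sym x≈))))

      -- The point `k · α` itself realises `D k`: from `K ≤ k` follows `n ∸ k ≤ k`, so the maximum
      -- in `nearest` is `k`.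
      D⇒nearestDistance : ∀ {k} → ⌈ n /2⌉ ≤ k → k ≤ n → NearestDistances X (suc n) α (D k)
      D⇒nearestDistance {k} K≤k k≤n = k · α , (k , s≤s k≤n , ≈-refl) ,
        subst (λ l → IsNearestDistance X (suc n) α (k · α) (D l))
          (ℕ.m≥n⇒m⊔n≡m (ℕ.m≤n+o⇒m∸n≤o n k
            (ℕ.≤-trans (n≤⌈n/2⌉+⌈n/2⌉ n) (ℕ.+-mono-≤ K≤k K≤k))))
          (nearest k≤n)

  -- The times are the places after `K` where `D` drops. `distinct` and `cover` speak of values of
  -- `D`, since they become injectivity and exhaustiveness in the enumeration of distances.
  record RecordsBetween (K L : ℕ) : Set ℓ where
    field
      number     : ℕ
      time       : Fin number → ℕ
      K<time     : ∀ i → K ℕ.< time i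
      time≤L     : ∀ i → time i ≤ L
      D-time     : ∀ i → D (time i) ≡ ‖ time i · α ‖
      D-time<D-K : ∀ i → D (time i) ℝ.< D K
      distinct   : ∀ {i j} → D (time i) ℝ.≈ D (time j) → i ≡ j
      cover      : ∀ {k} → K ≤ k → k ≤ L → D k ℝ.≈ D K ⊎ ∃[ i ] D k ℝ.≈ D (time i)

  -- Induction on the length of the interval. A new record is put at index `zero`, so the times
  -- decrease with the index.
  records : ∀ K t → RecordsBetween K (K + t)
  records K zero = record
    { number = 0
    ; time = λ ()
    ; K<time = λ ()
    ; time≤L = λ ()
    ; D-time = λ ()
    ; D-time<D-K = λ ()
    ; distinct = λ {}
    ; cover = λ K≤k k≤K → inj₁ (ℝ.reflexive (cong D
        (ℕ.≤-antisym (ℕ.≤-trans k≤K (ℕ.≤-reflexive (ℕ.+-identityʳ K))) K≤k)))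
    }
  records K (suc t) rewrite ℕ.+-suc K t = extend (D-step (K + t))
    where
    module R = RecordsBetween (records K t)
    L = K + t
    split : ∀ {k} → k ≤ suc L → k ≤ L ⊎ k ≡ suc L
    split k≤ with ℕ.m≤n⇒m<n∨m≡n k≤
    ... | inj₁ (s≤s k≤L) = inj₁ k≤L
    ... | inj₂ k≡        = inj₂ k≡

    extend : Step (suc L) (D L) (D (suc L)) → RecordsBetween K (suc L)
    extend (inj₁ (same , _)) = record
      { number = R.number
      ; time = R.time
      ; K<time = R.K<time
      ; time≤L = λ i → ℕ.≤-trans (R.time≤L i) (ℕ.n≤1+n L)
      ; D-time = R.D-time
      ; D-time<D-K = R.D-time<D-K
      ; distinct = R.distinct
      ; cover = cover
      }
      where
      cover : ∀ {k} → K ≤ k → k ≤ suc L → D k ℝ.≈ D K ⊎ ∃[ i ] D k ℝ.≈ D (R.time i)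
      cover K≤k k≤ with split k≤
      ... | inj₁ k≤L = R.cover K≤k k≤L
      ... | inj₂ refl rewrite same = R.cover (ℕ.m≤m+n K t) ℕ.≤-refl
    extend (inj₂ (new , smaller , _)) = record
      { number = suc R.number
      ; time = time
      ; K<time = λ { zero → s≤s (ℕ.m≤m+n K t) ; (suc i) → R.K<time i }
      ; time≤L = λ { zero → ℕ.≤-refl ; (suc i) → ℕ.≤-trans (R.time≤L i) (ℕ.n≤1+n L) }
      ; D-time = λ { zero → new ; (suc i) → R.D-time i }
      ; D-time<D-K = λ { zero → newest (ℕ.m≤m+n K t) ; (suc i) → R.D-time<D-K i }
      ; distinct = distinct
      ; cover = cover
      }
      where
      time : Fin (suc R.number) → ℕ
      time zero    = suc L
      time (suc i) = R.time i
      -- A record beats `D L`, hence all earlier values; its distinctness from the older records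
      -- rests on this.
      newest : ∀ {k} → k ≤ L → D (suc L) ℝ.< D k
      newest {k} k≤L = begin-strict
        D (suc L)          ≡⟨ new ⟩
        ‖ suc L · α ‖      <⟨ smaller ⟩
        D L                ≤⟨ D-antitone k≤L ⟩
        D k                ∎
        where open ≤-Reasoning ℝ.poset
      distinct : ∀ {i j} → D (time i) ℝ.≈ D (time j) → i ≡ j
      distinct {zero}  {zero}  _  = refl
      distinct {zero}  {suc j} eq = ⊥-elim (proj₂ (newest (R.time≤L j)) eq)
      distinct {suc i} {zero}  eq = ⊥-elim (proj₂ (newest (R.time≤L i)) (ℝ.sym eq))
      distinct {suc i} {suc j} eq = cong suc (R.distinct eq)
      cover : ∀ {k} → K ≤ k → k ≤ suc L → D k ℝ.≈ D K ⊎ ∃[ i ] D k ℝ.≈ D (time i)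
      cover K≤k k≤ with split k≤
      ... | inj₂ refl = inj₂ (zero , ℝ.refl)
      ... | inj₁ k≤L with R.cover K≤k k≤L
      ... | inj₁ eq       = inj₁ eq
      ... | inj₂ (i , eq) = inj₂ (suc i , eq)

-- From record times to the number of distances.

record SeparatedMultiples {ℓ : Level} {ℝ : CompleteOrderedField ℓ}
                          (X : NormedGroup ℝ) (α : NormedGroup.Carrier X) (r : ℕ) : Set ℓ where
  private module ℝ = CompleteOrderedField ℝ
  open NormedGroupLemmas X
  field
    δ         : ℝ.Carrier
    K         : ℕ
    time      : Fin r → ℕ
    -- Together the next two bounds say that no difference of two times exceeds a single time; the
    -- inner-product case compares multiples of one vector in this way.
    K≤time    : ∀ i → K ≤ time i
    gap       : ∀ i j → ℕ.∣ time i - time j ∣ ≤ K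
    short     : ∀ i → ‖ time i · α ‖ ℝ.< δ
    separated : ∀ {i j} → ¬ i ≡ j → δ ℝ.≤ dist (time i · α) (time j · α)

-- The inequality `g ≤ r + 1` absorbs the degenerate orbit: for vanishing `α` both numbers are `0`,
-- otherwise equality holds.
distanceCount : ∀ {ℓ} {ℝ : CompleteOrderedField ℓ} (X : NormedGroup ℝ) α N → 2 ≤ N →
                ∃[ g ] IsDistanceCount X N α g × ∃[ r ] g ≤ r + 1 × SeparatedMultiples X α r
distanceCount {ℓ} {ℝ} X α (suc n) (s≤s 1≤n) = count ℝ.excludedMiddle
  where
  module ℝ = CompleteOrderedField ℝ
  open NormedGroupLemmas X
  open Records X α

  trivial : SeparatedMultiples X α 0
  trivial = record
    { δ = ℝ.0# ; K = 0 ; time = λ () ; K≤time = λ () ; gap = λ () ; short = λ ()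
    ; separated = λ {} }

  ≈ε⇒·≈ε : α ≈ ε → ∀ m → m · α ≈ ε
  ≈ε⇒·≈ε α≈ε zero    = ≈-refl
  ≈ε⇒·≈ε α≈ε (suc m) = trans (∙-cong α≈ε (≈ε⇒·≈ε α≈ε m)) (identityˡ ε)

  count : Dec (α ≈ ε) → ∃[ g ] IsDistanceCount X (suc n) α g ×
          ∃[ r ] g ≤ r + 1 × SeparatedMultiples X α r
  count (yes α≈ε) = 0 , ((λ ()) , (λ {}) , (λ ()) , empty) , 0 , z≤n , trivial
    where
    empty : ∀ {r} → NearestDistances X (suc n) α r → ∃[ i ] r ℝ.≈ _
    empty (x , (j , _ , x≈) , (y , (i , _ , y≈) , y≉x , _) , _) =
      ⊥-elim (y≉x (trans y≈ (trans (≈ε⇒·≈ε α≈ε i) (sym (trans x≈ (≈ε⇒·≈ε α≈ε j))))))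
  count (no α≉ε) = suc R.number , (value , injective , isDistance , exhaustive) ,
                   R.number , ℕ.≤-reflexive (ℕ.+-comm 1 R.number) , separatedMultiples
    where
    K = ⌈ n /2⌉
    module R = RecordsBetween (subst (RecordsBetween K) (ℕ.m+[n∸m]≡n (ℕ.⌈n/2⌉≤n n)) (records K (n ℕ.∸ K)))

    value : Fin (suc R.number) → ℝ.Carrier
    value zero    = D K
    value (suc i) = D (R.time i)

    injective : ∀ {i j} → value i ℝ.≈ value j → i ≡ j
    injective {zero}  {zero}  _  = refl
    injective {zero}  {suc j} eq = ⊥-elim (proj₂ (R.D-time<D-K j) (ℝ.sym eq))
    injective {suc i} {zero}  eq = ⊥-elim (proj₂ (R.D-time<D-K i) eq)
    injective {suc i} {suc j} eq = cong suc (R.distinct eq)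

    isDistance : ∀ i → NearestDistances X (suc n) α (value i)
    isDistance zero    = D⇒nearestDistance α≉ε 1≤n ℕ.≤-refl (ℕ.⌈n/2⌉≤n n)
    isDistance (suc i) = D⇒nearestDistance α≉ε 1≤n (ℕ.<⇒≤ (R.K<time i)) (R.time≤L i)

    exhaustive : ∀ {r} → NearestDistances X (suc n) α r → ∃[ i ] r ℝ.≈ value i
    exhaustive Nr with nearestDistance⇒D α≉ε 1≤n Nr
    ... | k , K≤k , k≤n , r≈ with R.cover K≤k k≤n
    ... | inj₁ eq       = zero , ℝ.trans r≈ eq
    ... | inj₂ (i , eq) = suc i , ℝ.trans r≈ eq

    -- All times lie above `K` and up to `n`, and `n ≤ K + K`.
    gap : ∀ i j → ℕ.∣ R.time i - R.time j ∣ ≤ K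
    gap i j = ∣i-j∣≤k (close i j) (close j i)
      where
      close : ∀ i j → R.time i ≤ R.time j + K
      close i j = ℕ.≤-trans (R.time≤L i) (ℕ.≤-trans (n≤⌈n/2⌉+⌈n/2⌉ n)
        (ℕ.+-monoˡ-≤ K (ℕ.<⇒≤ (R.K<time j))))

    separatedMultiples : SeparatedMultiples X α R.number
    separatedMultiples = record
      { δ = D K
      ; K = K
      ; time = R.time
      ; K≤time = λ i → ℕ.<⇒≤ (R.K<time i)
      ; gap = gap
      ; short = λ i → subst (ℝ._< D K) (R.D-time i) (R.D-time<D-K i)
      -- Coinciding multiples would have equal norms, but these norms are the values of `D` at two
      -- different records.
      ; separated = λ {i} {j} i≢j → D-≤-dist (R.time i) (R.time j) (gap i j) λ i≈j → i≢j (R.distinct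
          (ℝ.trans (ℝ.reflexive (R.D-time i)) (ℝ.trans (‖‖-cong i≈j) (ℝ.sym (ℝ.reflexive (R.D-time j))))))
      }

-- Ordered fields: squares, reciprocals and finite choices of bounds.

module OrderedFieldLemmas {ℓ : Level} (ℝ : CompleteOrderedField ℓ) where
  open CompleteOrderedField ℝ public
    renaming (refl to ≈-refl; _+_ to _+ᴿ_; _≤_ to _≤ᴿ_; _<_ to _<ᴿ_; zero to *-zero)
  open AbelianGroupLemmas +-abelianGroup public using (_·_; ε⁻¹≈ε)
  open ≤-Reasoning poset

  1≰0 : ¬ 1# ≤ᴿ 0#
  1≰0 1≤0 = 0≉1 (≤-antisym 0≤1 1≤0)

  ≤-<-trans : ∀ {x y z} → x ≤ᴿ y → y <ᴿ z → x <ᴿ z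
  ≤-<-trans {x} {y} {z} x≤y y<z = begin-strict
    x  ≤⟨ x≤y ⟩
    y  <⟨ y<z ⟩
    z  ∎

  x<x+1 : ∀ x → x <ᴿ x +ᴿ 1#
  x<x+1 x = ≰⇒> λ x+1≤x → 1≰0 (begin
    1#              ≈⟨ xyx⁻¹≈y x 1# ⟨
    x +ᴿ 1# - x     ≤⟨ +-monoˡ-≤ (- x) x+1≤x ⟩
    x - x           ≈⟨ -‿inverseʳ x ⟩
    0#              ∎)
    where open AbelianGroupLemmas +-abelianGroup using (xyx⁻¹≈y)

  0≤x⇒∣x∣≈x : ∀ {x} → 0# ≤ᴿ x → ∣ x ∣ ≈ x
  0≤x⇒∣x∣≈x {x} 0≤x = ≤-antisym
    (⊔-lub ≤-refl (begin
      - x    ≤⟨ neg-mono-≤ 0≤x ⟩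
      - 0#   ≈⟨ ε⁻¹≈ε ⟩
      0#     ≤⟨ 0≤x ⟩
      x      ∎))
    (x≤x⊔y x (- x))

  *-monoˡ-≤ : ∀ {z x y} → 0# ≤ᴿ z → x ≤ᴿ y → z * x ≤ᴿ z * y
  *-monoˡ-≤ {z} {x} {y} 0≤z x≤y = begin
    z * x   ≈⟨ *-comm z x ⟩
    x * z   ≤⟨ *-monoʳ-≤ 0≤z x≤y ⟩
    y * z   ≈⟨ *-comm y z ⟩
    z * y   ∎

  square-mono-≤ : ∀ {x y} → 0# ≤ᴿ x → x ≤ᴿ y → x * x ≤ᴿ y * y
  square-mono-≤ 0≤x x≤y = ≤-trans (*-monoˡ-≤ 0≤x x≤y) (*-monoʳ-≤ (≤-trans 0≤x x≤y) x≤y)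

  square-cancel-< : ∀ {x y} → 0# ≤ᴿ y → x * x <ᴿ y * y → x <ᴿ y
  square-cancel-< 0≤y x²<y² = ≰⇒> λ y≤x → <⇒≱ x²<y² (square-mono-≤ 0≤y y≤x)

  module Reciprocal {c : Carrier} (0<c : 0# <ᴿ c) where
    private
      c⁻¹ = inverse c λ c≈0 → proj₂ 0<c (sym c≈0)

    s : Carrier
    s = proj₁ c⁻¹

    cs≈1 : c * s ≈ 1#
    cs≈1 = proj₂ c⁻¹

    sc≈1 : s * c ≈ 1#
    sc≈1 = trans (*-comm s c) cs≈1

    0≤s : 0# ≤ᴿ s
    0≤s with total 0# s
    ... | inj₁ 0≤s = 0≤s
    ... | inj₂ s≤0 = ⊥-elim (1≰0 (begin
      1#      ≈⟨ sc≈1 ⟨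
      s * c   ≤⟨ *-monoʳ-≤ (proj₁ 0<c) s≤0 ⟩
      0# * c  ≈⟨ zeroˡ c ⟩
      0#      ∎))

    s*[c*x]≈x : ∀ x → s * (c * x) ≈ x
    s*[c*x]≈x x = trans (sym (*-assoc s c x)) (trans (*-congʳ sc≈1) (*-identityˡ x))

    *-cancelˡ-≤ : ∀ {x y} → c * x ≤ᴿ c * y → x ≤ᴿ y
    *-cancelˡ-≤ {x} {y} cx≤cy = begin
      x            ≈⟨ s*[c*x]≈x x ⟨
      s * (c * x)  ≤⟨ *-monoˡ-≤ 0≤s cx≤cy ⟩
      s * (c * y)  ≈⟨ s*[c*x]≈x y ⟩
      y            ∎

    c≤x⇒1≤sx : ∀ {x} → c ≤ᴿ x → 1# ≤ᴿ s * x
    c≤x⇒1≤sx {x} c≤x = begin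
      1#     ≈⟨ sc≈1 ⟨
      s * c  ≤⟨ *-monoˡ-≤ 0≤s c≤x ⟩
      s * x  ∎

    x<c⇒sx<1 : ∀ {x} → x <ᴿ c → s * x <ᴿ 1#
    x<c⇒sx<1 {x} x<c = ≰⇒> λ 1≤sx → <⇒≱ x<c (begin
      c            ≈⟨ *-identityʳ c ⟨
      c * 1#       ≤⟨ *-monoˡ-≤ (proj₁ 0<c) 1≤sx ⟩
      c * (s * x)  ≈⟨ *-assoc c s x ⟨
      c * s * x    ≈⟨ *-congʳ cs≈1 ⟩
      1# * x       ≈⟨ *-identityˡ x ⟩
      x            ∎)

  square-mono-< : ∀ {x y} → 0# ≤ᴿ x → x <ᴿ y → x * x <ᴿ y * y
  square-mono-< {x} {y} 0≤x x<y = ≰⇒> λ y²≤x² → <⇒≱ x<y (*-cancelˡ-≤ (begin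
    y * y  ≤⟨ y²≤x² ⟩
    x * x  ≤⟨ *-monoʳ-≤ 0≤x (proj₁ x<y) ⟩
    y * x  ∎))
    where open Reciprocal (≤-<-trans 0≤x x<y)

  square-cancel-≤ : ∀ {x y} → 0# ≤ᴿ y → x * x ≤ᴿ y * y → x ≤ᴿ y
  square-cancel-≤ {x} {y} 0≤y x²≤y² with x ≤? y
  ... | yes x≤y = x≤y
  ... | no  x≰y = ⊥-elim (<⇒≱ (square-mono-< 0≤y (≰⇒> x≰y)) x²≤y²)

  ·1-nonneg : ∀ n → 0# ≤ᴿ n · 1#
  ·1-nonneg zero    = ≤-refl
  ·1-nonneg (suc n) = begin
    0#              ≈⟨ +-identityˡ 0# ⟨
    0# +ᴿ 0#        ≤⟨ +-mono-≤ 0≤1 (·1-nonneg n) ⟩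
    1# +ᴿ n · 1#    ∎

  ·1-mono-≤ : ∀ {m n} → m ≤ n → m · 1# ≤ᴿ n · 1#
  ·1-mono-≤ {n = n} z≤n = ·1-nonneg n
  ·1-mono-≤ (s≤s m≤n)   = +-mono-≤ ≤-refl (·1-mono-≤ m≤n)

  maximum : ∀ {n} (f : Fin (suc n) → Carrier) → ∃[ i ] ∀ j → f j ≤ᴿ f i
  maximum {zero}  f = zero , λ { zero → ≤-refl }
  maximum {suc n} f with maximum (λ i → f (suc i))
  ... | i , max with total (f zero) (f (suc i))
  ... | inj₁ le = suc i , λ { zero → le ; (suc j) → max j }
  ... | inj₂ ge = zero , λ { zero → ≤-refl ; (suc j) → ≤-trans (max j) ge }

  -- The smaller of two admissible values stays admissible, as `Q` is downward closed. With no
  -- conditions any value above `x` does, such as `x + 1`.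
  common-bound : ∀ {n} {x} (Q : Fin n → Carrier → Set ℓ) →
                 (∀ {i y z} → y ≤ᴿ z → Q i z → Q i y) →
                 (∀ i → ∃[ y ] x <ᴿ y × Q i y) → ∃[ y ] x <ᴿ y × ∀ i → Q i y
  common-bound {zero}  {x} Q down bounds = x +ᴿ 1# , x<x+1 x , λ ()
  common-bound {suc n} Q down bounds
    with bounds zero | common-bound (λ i → Q (suc i)) down (λ i → bounds (suc i))
  ... | y , x<y , Qy | z , x<z , Qz with total y z
  ... | inj₁ y≤z = y , x<y , λ { zero → Qy ; (suc i) → down y≤z (Qz i) }
  ... | inj₂ z≤y = z , x<z , λ { zero → down z≤y Qy ; (suc i) → Qz i }

  -- Rescaling to the unit ball needs one threshold for all indices. The largest `f i` lies strictly
  -- below each off-diagonal `g j k`, and there are finitely many of these.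
  separating-constant : ∀ {n} (f : Fin (suc n) → Carrier) (g : Fin (suc n) → Fin (suc n) → Carrier) →
    (∀ i {j k} → ¬ j ≡ k → f i <ᴿ g j k) →
    ∃[ c ] (∀ i → f i <ᴿ c) × (∀ {j k} → ¬ j ≡ k → c ≤ᴿ g j k)
  separating-constant {n} f g f<g = c , (λ j → ≤-<-trans (f≤max j) max<c) , λ {j} {k} → c≤ j k
    where
    i = proj₁ (maximum f)
    f≤max = proj₂ (maximum f)
    bound : ∀ j k → ∃[ y ] f i <ᴿ y × (¬ j ≡ k → y ≤ᴿ g j k)
    bound j k with j Fin.≟ k
    ... | yes j≡k = f i +ᴿ 1# , x<x+1 (f i) , λ j≢k → ⊥-elim (j≢k j≡k)
    ... | no  j≢k = g j k , f<g i j≢k , λ _ → ≤-refl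
    bounds : ∀ j → ∃[ y ] f i <ᴿ y × (∀ k → ¬ j ≡ k → y ≤ᴿ g j k)
    bounds j = common-bound (λ k y → ¬ j ≡ k → y ≤ᴿ g j k)
      (λ y≤z z≤ j≢k → ≤-trans y≤z (z≤ j≢k)) (bound j)
    bound-all : ∃[ y ] f i <ᴿ y × (∀ j k → ¬ j ≡ k → y ≤ᴿ g j k)
    bound-all = common-bound (λ j y → ∀ k → ¬ j ≡ k → y ≤ᴿ g j k)
      (λ y≤z z≤ k j≢k → ≤-trans y≤z (z≤ k j≢k)) bounds
    c = proj₁ bound-all
    max<c = proj₁ (proj₂ bound-all)
    c≤ = proj₂ (proj₂ bound-all)

-- Packings and quotient norms.

packing-bound : ∀ {ℓ} {ℝ : CompleteOrderedField ℓ} (Y : NormedGroup ℝ) {P} → IsPackingNumber Y P →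
  let open CompleteOrderedField ℝ using (1#) renaming (_≤_ to _≤ᴿ_; _<_ to _<ᴿ_); open NormedGroup Y in
  ∀ {r} (y : Fin r → Carrier) → (∀ i → ‖ y i ‖ <ᴿ 1#) →
  (∀ {i j} → ¬ i ≡ j → 1# ≤ᴿ dist (y i) (y j)) → r ≤ P
packing-bound {ℝ = ℝ} Y (_ , largest) y y<1 separated =
  -- The packing is the image of `y`, closed under `≈` and enumerated by `y` itself; separation
  -- makes `y` injective, as equal points have distance `0`.
  largest {λ v → ∃[ i ] v ≈ y i} (inBall , separated′)
    (y , injective , (λ i → i , ≈-refl) , λ Sv → Sv)
  where
  open NormedGroupLemmas Y
  module ℝ = OrderedFieldLemmas ℝ
  open ℝ using (_≤ᴿ_; _<ᴿ_; 1#)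
  inBall : ∀ {v} → ∃[ i ] v ≈ y i → ‖ v ‖ <ᴿ 1#
  inBall (i , v≈) = ℝ.≤-<-trans (ℝ.≤-reflexive (‖‖-cong v≈)) (y<1 i)
  separated′ : ∀ {v w} → ∃[ i ] v ≈ y i → ∃[ j ] w ≈ y j → ¬ v ≈ w → 1# ≤ᴿ dist v w
  separated′ (i , v≈) (j , w≈) v≉w = ℝ.≤-trans
    (separated λ { refl → v≉w (trans v≈ (sym w≈)) })
    (ℝ.≤-reflexive (‖‖-cong (∙-cong (sym v≈) (⁻¹-cong (sym w≈)))))
  injective : ∀ {i j} → y i ≈ y j → i ≡ j
  injective {i} {j} yi≈yj with i Fin.≟ j
  ... | yes i≡j = i≡j
  ... | no  i≢j = ⊥-elim (ℝ.1≰0 (ℝ.≤-trans (separated i≢j)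
    (ℝ.≤-reflexive (ℝ.trans (‖‖-cong (x≈y⇒x∙y⁻¹≈ε yi≈yj)) ‖ε‖≈0))))

module QuotientLemmas {ℓ : Level} {ℝ : CompleteOrderedField ℓ}
                      (G : NormedGroup ℝ) (H : Subgroup G) (closed : IsClosed H) where
  private
    module ℝ = OrderedFieldLemmas ℝ
    module H = Subgroup H
    module Q = NormedGroup (quotient G H closed)
  open NormedGroupLemmas G
  open ℝ using (_≤ᴿ_; _<ᴿ_)

  -- The infimum need not be attained, but some representative stays below any strict upper bound;
  -- hence the strict inequality in `short`.
  quotientNorm-lift : ∀ {x r} → Q.‖ x ‖ <ᴿ r → ∃[ y ] x Q.≈ y × ‖ y ‖ <ᴿ r
  quotientNorm-lift {x} ‖x‖<r with proj₂ (quotientNorm-isInfimum G H closed x) ‖x‖<r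
  ... | _ , (h , Hh , eq) , <r =
    x - h , H.∋-resp (sym (x-[x-y]≈y x h)) Hh , ℝ.≤-<-trans (ℝ.≤-reflexive (ℝ.sym eq)) <r

  quotientNorm-lower : ∀ {x y} → x Q.≈ y → Q.‖ x ‖ ≤ᴿ ‖ y ‖
  quotientNorm-lower {x} {y} x≈y = ℝ.≤-trans
    (proj₁ (quotientNorm-isInfimum G H closed x) (x - y , x≈y , ℝ.≈-refl))
    (ℝ.≤-reflexive (‖‖-cong (x-[x-y]≈y x y)))

  quotientNorm-greatest : ∀ {x r} → (∀ {h} → H ∋ h → r ≤ᴿ ‖ x - h ‖) → r ≤ᴿ Q.‖ x ‖
  quotientNorm-greatest {x} r≤ = ℝ.infimum-greatest (quotientNorm-isInfimum G H closed x)
    λ (h , Hh , eq) → ℝ.≤-trans (r≤ Hh) (ℝ.≤-reflexive (ℝ.sym eq))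

-- Positivity of the scale `δ` is read off from some index; without indices the bound is trivial.
≤-ifInhabited : ∀ {m n} → (Fin m → m ≤ n) → m ≤ n
≤-ifInhabited {zero}  _ = z≤n
≤-ifInhabited {suc m} f = f zero

-- Scaling in normed spaces and the ultrametric inequality.

module NormedSpaceLemmas {ℓ : Level} {ℝ : CompleteOrderedField ℓ} (V : NormedSpace ℝ) where
  private module ℝ = OrderedFieldLemmas ℝ
  open ℝ using (_≤ᴿ_; _<ᴿ_)
  open NormedSpace V public using
    ( normedGroup; _*ₗ_; *ₗ-cong; *ₗ-assoc; *ₗ-identityˡ; *ₗ-zeroˡ; *ₗ-zeroʳ
    ; *ₗ-distribˡ; *ₗ-distribʳ; *ₗ-distrib--; -1*v≈-v; homogeneous )
  open NormedGroupLemmas normedGroup public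

  ‖s*v‖≈s*‖v‖ : ∀ {s} v → ℝ.0# ≤ᴿ s → ‖ s *ₗ v ‖ ℝ.≈ s ℝ.* ‖ v ‖
  ‖s*v‖≈s*‖v‖ v 0≤s = ℝ.trans (homogeneous _ v) (ℝ.*-congʳ (ℝ.0≤x⇒∣x∣≈x 0≤s))

  n·v≈[n·1]*v : ∀ n v → n · v ≈ (n ℝ.· ℝ.1#) *ₗ v
  n·v≈[n·1]*v zero    v = sym (*ₗ-zeroˡ v)
  n·v≈[n·1]*v (suc n) v = trans (∙-cong (sym (*ₗ-identityˡ v)) (n·v≈[n·1]*v n v))
    (sym (*ₗ-distribʳ v ℝ.1# (n ℝ.· ℝ.1#)))

  ‖n·v‖≈[n·1]*‖v‖ : ∀ n v → ‖ n · v ‖ ℝ.≈ (n ℝ.· ℝ.1#) ℝ.* ‖ v ‖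
  ‖n·v‖≈[n·1]*‖v‖ n v = ℝ.trans (‖‖-cong (n·v≈[n·1]*v n v)) (‖s*v‖≈s*‖v‖ v (ℝ.·1-nonneg n))

  ‖·‖-mono-≤ : ∀ {m n} v → m ≤ n → ‖ m · v ‖ ≤ᴿ ‖ n · v ‖
  ‖·‖-mono-≤ {m} {n} v m≤n = begin
    ‖ m · v ‖                      ≈⟨ ‖n·v‖≈[n·1]*‖v‖ m v ⟩
    (m ℝ.· ℝ.1#) ℝ.* ‖ v ‖         ≤⟨ ℝ.*-monoʳ-≤ (‖‖-nonneg v) (ℝ.·1-mono-≤ m≤n) ⟩
    (n ℝ.· ℝ.1#) ℝ.* ‖ v ‖         ≈⟨ ‖n·v‖≈[n·1]*‖v‖ n v ⟨
    ‖ n · v ‖                      ∎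
    where open ≤-Reasoning ℝ.poset

  module Rescale {c : ℝ.Carrier} (0<c : ℝ.0# <ᴿ c) where
    open ℝ.Reciprocal 0<c public

    ‖v‖<c⇒‖sv‖<1 : ∀ {v} → ‖ v ‖ <ᴿ c → ‖ s *ₗ v ‖ <ᴿ ℝ.1#
    ‖v‖<c⇒‖sv‖<1 {v} <c = ℝ.≤-<-trans (ℝ.≤-reflexive (‖s*v‖≈s*‖v‖ v 0≤s)) (x<c⇒sx<1 <c)

    c≤‖v‖⇒1≤‖sv‖ : ∀ {v} → c ≤ᴿ ‖ v ‖ → ℝ.1# ≤ᴿ ‖ s *ₗ v ‖
    c≤‖v‖⇒1≤‖sv‖ {v} c≤ = ℝ.≤-trans (c≤x⇒1≤sx c≤) (ℝ.≤-reflexive (ℝ.sym (‖s*v‖≈s*‖v‖ v 0≤s)))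

module UltrametricLemmas {ℓ : Level} {ℝ : CompleteOrderedField ℓ} (U : UltrametricGroup ℝ) where
  private
    module ℝ = OrderedFieldLemmas ℝ
    module U = UltrametricGroup U
    module d = IsGeneralMetric U.isUltrametric
  open ℝ using (_≤ᴿ_)
  open NormedGroupLemmas U.normedGroup public

  ‖u-w‖≤‖u‖⊔‖w‖ : ∀ u w → ‖ u - w ‖ ≤ᴿ ‖ u ‖ ℝ.⊔ ‖ w ‖
  ‖u-w‖≤‖u‖⊔‖w‖ u w = begin
    ‖ u - w ‖                                    ≤⟨ d.triangle (u - w) (w ⁻¹) ε ⟩
    U.d (u - w) (w ⁻¹) ℝ.⊔ ‖ w ⁻¹ ‖              ≈⟨ ℝ.⊔-cong (d.cong ≈-refl (sym (identityˡ (w ⁻¹)))) (‖⁻¹‖ w) ⟩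
    U.d (u - w) (ε ∙ w ⁻¹) ℝ.⊔ ‖ w ‖             ≈⟨ ℝ.⊔-cong U.translationInvariant ℝ.≈-refl ⟩
    ‖ u ‖ ℝ.⊔ ‖ w ‖                              ∎
    where open ≤-Reasoning ℝ.poset

-- Lifts of the record multiples and the bound by the reduced factor.

module Lifting {ℓ : Level} {ℝ : CompleteOrderedField ℓ} (V : NormedSpace ℝ) (U : UltrametricGroup ℝ)
               (Λ : Subgroup (ambient V U)) (closed : IsClosed Λ) where
  private
    module ℝ = OrderedFieldLemmas ℝ
    module V = NormedSpaceLemmas V
    module U = UltrametricLemmas U
    module X = NormedGroupLemmas (X V U Λ closed)
  open ℝ using (_≤ᴿ_; _<ᴿ_)
  open QuotientLemmas (ambient V U) Λ closed public

  -- The ultrametric makes U-components shorter than r stay closer than r to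
  -- each other, so separation in X is witnessed by the V-components.
  V-separated : ∀ {r x y v u v′ u′} → r ≤ᴿ X.dist x y → x X.≈ (v , u) → y X.≈ (v′ , u′) →
                U.‖ u ‖ <ᴿ r → U.‖ u′ ‖ <ᴿ r → r ≤ᴿ V.dist v v′
  V-separated {r} {x} {y} {v} {u} {v′} {u′} r≤ x≈ y≈ u<r u′<r
    with ℝ.⊔-sel V.‖ v V.- v′ ‖ U.‖ u U.- u′ ‖
       | ℝ.≤-trans r≤ (quotientNorm-lower (X.∙-cong x≈ (X.⁻¹-cong y≈)))
  ... | inj₁ eq | r≤⊔ = ℝ.≤-trans r≤⊔ (ℝ.≤-reflexive eq)
  ... | inj₂ eq | r≤⊔
    with ℝ.≤-trans (ℝ.≤-trans r≤⊔ (ℝ.≤-reflexive eq)) (U.‖u-w‖≤‖u‖⊔‖w‖ u u′)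
       | ℝ.⊔-sel U.‖ u ‖ U.‖ u′ ‖
  ... | r≤ | inj₁ eq′ = ⊥-elim (ℝ.<⇒≱ u<r (ℝ.≤-trans r≤ (ℝ.≤-reflexive eq′)))
  ... | r≤ | inj₂ eq′ = ⊥-elim (ℝ.<⇒≱ u′<r (ℝ.≤-trans r≤ (ℝ.≤-reflexive eq′)))

  W-shift : ∀ {v v′} u → W V U Λ ∋ (v V.- v′) → (v , u) X.≈ (v′ , u)
  W-shift u Ww = Subgroup.∋-resp Λ (V.*ₗ-identityˡ _ , U.sym (U.inverseʳ u)) (Ww ℝ.1#)

  W-* : ∀ t {w} → W V U Λ ∋ w → W V U Λ ∋ (t V.*ₗ w)
  W-* t {w} Ww t′ = Subgroup.∋-resp Λ (V.*ₗ-assoc t′ t w , U.≈-refl) (Ww (t′ ℝ.* t))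

  module _ {α : X.Carrier} {r : ℕ} (S : SeparatedMultiples (X V U Λ closed) α r) where
    open SeparatedMultiples S

    record Lift (i : Fin r) : Set ℓ where
      field
        v    : V.Carrier
        u    : U.Carrier
        lift : time i X.· α X.≈ (v , u)
        v<δ  : V.‖ v ‖ <ᴿ δ
        u<δ  : U.‖ u ‖ <ᴿ δ

    lifts : ∀ i → Lift i
    lifts i with quotientNorm-lift (short i)
    ... | (v , u) , x≈ , <δ = record
      { lift = x≈ ; v<δ = ℝ.≤-<-trans (ℝ.x≤x⊔y _ _) <δ ; u<δ = ℝ.≤-<-trans (ℝ.x≤y⊔x _ _) <δ }

    private module L i = Lift (lifts i)

    -- The `V`-components may move within their classes while the `U`-components stay. Shifts by `W`
    -- are of this kind, so this yields separation modulo `W` and separation of the projections to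
    -- `W⊥`.
    lift-separated : ∀ {i j v v′} → ¬ i ≡ j → (L.v i , L.u i) X.≈ (v , L.u i) →
                     (L.v j , L.u j) X.≈ (v′ , L.u j) → δ ≤ᴿ V.dist v v′
    lift-separated {i} {j} i≢j v≈ v′≈ =
      V-separated (separated i≢j) (X.trans (L.lift i) v≈) (X.trans (L.lift j) v′≈) (L.u<δ i) (L.u<δ j)

    0<δ : Fin r → ℝ.0# <ᴿ δ
    0<δ i = ℝ.≤-<-trans (X.‖‖-nonneg _) (short i)

    -- The lifts are scaled by the inverse of `δ`. Shortness passes to the quotient directly;
    -- separation is tested against every `w` in `W`, since the quotient norm is an infimum.
    reducedFactor-bound : ∀ {P} → IsPackingNumber (reducedFactor V U Λ closed) P → r ≤ P
    reducedFactor-bound {P} isP = ≤-ifInhabited λ i₀ → bound (0<δ i₀)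
      where
      module V/W = NormedGroup (reducedFactor V U Λ closed)
      open QuotientLemmas V.normedGroup (W V U Λ) (W-closed V U Λ closed)
        using () renaming (quotientNorm-lower to lower; quotientNorm-greatest to greatest)

      bound : ℝ.0# <ᴿ δ → r ≤ P
      bound 0<δ = packing-bound (reducedFactor V U Λ closed) isP (λ i → s V.*ₗ L.v i)
        (λ i → ℝ.≤-<-trans (lower V/W.refl) (‖v‖<c⇒‖sv‖<1 (L.v<δ i)))
        (λ i≢j → greatest (far i≢j))
        where
        open V.Rescale 0<δ
        -- The vector `w` enters as `δ *ₗ w`, absorbed into the lift of index `j`; scaling by `s`
        -- restores `w`.
        far : ∀ {i j} → ¬ i ≡ j → ∀ {w} → W V U Λ ∋ w →
              ℝ.1# ≤ᴿ V.‖ (s V.*ₗ L.v i V.- s V.*ₗ L.v j) V.- w ‖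
        far {i} {j} i≢j {w} Ww = ℝ.≤-trans
          (c≤‖v‖⇒1≤‖sv‖ (lift-separated i≢j X.≈-refl (X.sym (W-shift (L.u j) W∋δw))))
          (ℝ.≤-reflexive (V.‖‖-cong (begin
            s V.*ₗ (L.v i V.- (L.v j V.∙ (δ V.*ₗ w)))                     ≈⟨ V.*ₗ-distrib-- s _ _ ⟩
            s V.*ₗ L.v i V.- s V.*ₗ (L.v j V.∙ (δ V.*ₗ w))
              ≈⟨ V.∙-congˡ (V.⁻¹-cong (V.*ₗ-distribˡ s (L.v j) (δ V.*ₗ w))) ⟩
            s V.*ₗ L.v i V.- ((s V.*ₗ L.v j) V.∙ (s V.*ₗ (δ V.*ₗ w)))     ≈⟨ V.x-[y∙z]≈x-y-z _ _ _ ⟩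
            (s V.*ₗ L.v i V.- s V.*ₗ L.v j) V.- s V.*ₗ (δ V.*ₗ w)         ≈⟨ V.∙-congˡ (V.⁻¹-cong s*[δ*w]≈w) ⟩
            (s V.*ₗ L.v i V.- s V.*ₗ L.v j) V.- w                         ∎)))
          where
          open ≈-Reasoning V.setoid
          W∋δw : W V U Λ ∋ (L.v j V.∙ (δ V.*ₗ w) V.- L.v j)
          W∋δw = Subgroup.∋-resp (W V U Λ) (V.sym (V.xyx⁻¹≈y (L.v j) (δ V.*ₗ w))) (W-* δ Ww)
          s*[δ*w]≈w : s V.*ₗ (δ V.*ₗ w) V.≈ w
          s*[δ*w]≈w = V.trans (V.sym (V.*ₗ-assoc s δ w))
            (V.trans (V.*ₗ-cong sc≈1 V.≈-refl) (V.*ₗ-identityˡ w))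

-- Orthogonal projections in finite dimension.

module InnerProductLemmas {ℓ : Level} {ℝ : CompleteOrderedField ℓ} (V : NormedSpace ℝ) (ip : InnerProduct V) where
  private module ℝ = OrderedFieldLemmas ℝ
  open ℝ using (_≤ᴿ_; _+ᴿ_)
  open NormedSpaceLemmas V
  open InnerProduct ip

  record IsSubspace (S : Carrier → Set ℓ) : Set ℓ where
    field
      resp   : ∀ {v w} → v ≈ w → S v → S w
      0-∈    : S ε
      +-∈    : ∀ {v w} → S v → S w → S (v ∙ w)
      *-∈    : ∀ t {v} → S v → S (t *ₗ v)

    ⁻¹-∈ : ∀ {v} → S v → S (v ⁻¹)
    ⁻¹-∈ Sv = resp (-1*v≈-v _) (*-∈ (ℝ.- ℝ.1#) Sv)

    -‿∈ : ∀ {v w} → S v → S w → S (v - w)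
    -‿∈ Sv Sw = +-∈ Sv (⁻¹-∈ Sw)

    ·-∈ : ∀ n {v} → S v → S (n · v)
    ·-∈ zero    Sv = 0-∈
    ·-∈ (suc n) Sv = +-∈ Sv (·-∈ n Sv)

  span-isSubspace : ∀ S → IsSubspace (Span V S)
  span-isSubspace S = record { resp = respects ; 0-∈ = zero ; +-∈ = _+ˢ_ ; *-∈ = _*ˢ_ }

  span-least : ∀ {S T} → IsSubspace T → (∀ {v} → S v → T v) → ∀ {v} → Span V S v → T v
  span-least T S⊆T (generator Sv)      = S⊆T Sv
  span-least T S⊆T zero                = IsSubspace.0-∈ T
  span-least T S⊆T (v +ˢ w)            = IsSubspace.+-∈ T (span-least T S⊆T v) (span-least T S⊆T w)
  span-least T S⊆T (t *ˢ v)            = IsSubspace.*-∈ T t (span-least T S⊆T v)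
  span-least T S⊆T (respects v≈w v)    = IsSubspace.resp T v≈w (span-least T S⊆T v)

  ⟨⟩-⁻¹ : ∀ v w → ⟨ v ⁻¹ , w ⟩ ℝ.≈ ℝ.- ⟨ v , w ⟩
  ⟨⟩-⁻¹ v w = ℝ.trans (⟨⟩-cong (sym (-1*v≈-v v)) ≈-refl)
    (ℝ.trans (⟨⟩-* (ℝ.- ℝ.1#) v w) (RingProperties.-1*x≈-x ℝ.ring ⟨ v , w ⟩))

  infix 4 _⊥_
  _⊥_ : Carrier → Carrier → Set ℓ
  v ⊥ w = ⟨ v , w ⟩ ℝ.≈ ℝ.0#

  ⊥-sym : ∀ {v w} → v ⊥ w → w ⊥ v
  ⊥-sym v⊥w = ℝ.trans (⟨⟩-sym _ _) v⊥w

  ⊥-isSubspace : ∀ w → IsSubspace (_⊥ w)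
  ⊥-isSubspace w = record
    { resp = λ v≈ v⊥w → ℝ.trans (⟨⟩-cong (sym v≈) ≈-refl) v⊥w
    ; 0-∈ = ℝ.trans (⟨⟩-cong (sym (*ₗ-zeroˡ ε)) ≈-refl)
        (ℝ.trans (⟨⟩-* ℝ.0# ε w) (ℝ.zeroˡ _))
    ; +-∈ = λ {v} {v′} v⊥w v′⊥w → ℝ.trans (⟨⟩-+ v v′ w)
        (ℝ.trans (ℝ.+-cong v⊥w v′⊥w) (ℝ.+-identityˡ ℝ.0#))
    ; *-∈ = λ t {v} v⊥w → ℝ.trans (⟨⟩-* t v w) (ℝ.trans (ℝ.*-congˡ v⊥w) (ℝ.zeroʳ t))
    }

  ⊥ʳ-isSubspace : ∀ v → IsSubspace (v ⊥_)
  ⊥ʳ-isSubspace v = record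
    { resp = λ w≈ v⊥w → ⊥-sym (resp w≈ (⊥-sym v⊥w))
    ; 0-∈ = ⊥-sym 0-∈
    ; +-∈ = λ v⊥w v⊥w′ → ⊥-sym (+-∈ (⊥-sym v⊥w) (⊥-sym v⊥w′))
    ; *-∈ = λ t v⊥w → ⊥-sym (*-∈ t (⊥-sym v⊥w))
    }
    where open IsSubspace (⊥-isSubspace v)

  ‖_‖² : Carrier → ℝ.Carrier
  ‖ v ‖² = ‖ v ‖ ℝ.* ‖ v ‖

  ‖‖²-cong : ∀ {v w} → v ≈ w → ‖ v ‖² ℝ.≈ ‖ w ‖²
  ‖‖²-cong v≈w = ℝ.*-cong (‖‖-cong v≈w) (‖‖-cong v≈w)

  pythagoras : ∀ {v w} → v ⊥ w → ‖ v ∙ w ‖² ℝ.≈ ‖ v ‖² +ᴿ ‖ w ‖²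
  pythagoras {v} {w} v⊥w = begin
    ‖ v ∙ w ‖²                                  ≈⟨ induces (v ∙ w) ⟩
    ⟨ v ∙ w , v ∙ w ⟩                           ≈⟨ ⟨⟩-+ v w (v ∙ w) ⟩
    ⟨ v , v ∙ w ⟩ +ᴿ ⟨ w , v ∙ w ⟩              ≈⟨ ℝ.+-cong (expand v) (expand w) ⟩
    (⟨ v , v ⟩ +ᴿ ⟨ w , v ⟩) +ᴿ (⟨ v , w ⟩ +ᴿ ⟨ w , w ⟩)
      ≈⟨ ℝ.+-cong (trim (⊥-sym v⊥w)) (ℝ.trans (ℝ.+-comm _ _) (trim v⊥w)) ⟩
    ⟨ v , v ⟩ +ᴿ ⟨ w , w ⟩                      ≈⟨ ℝ.+-cong (induces v) (induces w) ⟨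
    ‖ v ‖² +ᴿ ‖ w ‖²                            ∎
    where
    open ≈-Reasoning ℝ.setoid
    expand : ∀ x → ⟨ x , v ∙ w ⟩ ℝ.≈ ⟨ v , x ⟩ +ᴿ ⟨ w , x ⟩
    expand x = ℝ.trans (⟨⟩-sym x (v ∙ w)) (⟨⟩-+ v w x)
    trim : ∀ {x y} → y ℝ.≈ ℝ.0# → x +ᴿ y ℝ.≈ x
    trim y≈0 = ℝ.trans (ℝ.+-congˡ y≈0) (ℝ.+-identityʳ _)

  ⊥⇒‖v‖²≤‖v+w‖² : ∀ {v w} → v ⊥ w → ‖ v ‖² ≤ᴿ ‖ v ∙ w ‖²
  ⊥⇒‖v‖²≤‖v+w‖² {v} {w} v⊥w = begin
    ‖ v ‖²              ≈⟨ ℝ.+-identityʳ _ ⟨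
    ‖ v ‖² +ᴿ ℝ.0#      ≤⟨ ℝ.+-mono-≤ ℝ.≤-refl (ℝ.*-nonneg (‖‖-nonneg w) (‖‖-nonneg w)) ⟩
    ‖ v ‖² +ᴿ ‖ w ‖²    ≈⟨ pythagoras v⊥w ⟨
    ‖ v ∙ w ‖²          ∎
    where open ≤-Reasoning ℝ.poset

  -- The linear span, with generators peeled off one at a time to suit induction on the list.
  InSpan : List Carrier → Carrier → Set ℓ
  InSpan []       v = v ≈ ε
  InSpan (b ∷ bs) v = ∃[ c ] InSpan bs (v - c *ₗ b)

  inSpan-isSubspace : ∀ bs → IsSubspace (InSpan bs)
  inSpan-isSubspace [] = record
    { resp = λ v≈w v≈0 → trans (sym v≈w) v≈0
    ; 0-∈ = ≈-refl
    ; +-∈ = λ v≈0 w≈0 → trans (∙-cong v≈0 w≈0) (identityˡ ε)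
    ; *-∈ = λ t v≈0 → trans (*ₗ-cong ℝ.≈-refl v≈0) (*ₗ-zeroʳ t)
    }
  inSpan-isSubspace (b ∷ bs) = record
    { resp = λ v≈w (c , v∈) → c , resp (∙-congʳ v≈w) v∈
    ; 0-∈ = ℝ.0# , resp (sym (trans (∙-congˡ (⁻¹-cong (*ₗ-zeroˡ b))) (inverseʳ ε))) 0-∈
    ; +-∈ = λ {v} {w} (c , v∈) (d , w∈) → c +ᴿ d , resp
        (sym (trans (∙-congˡ (⁻¹-cong (*ₗ-distribʳ b c d))) (//-∙-distrib v w _ _))) (+-∈ v∈ w∈)
    ; *-∈ = λ t {v} (c , v∈) → t ℝ.* c , resp
        (trans (*ₗ-distrib-- t v (c *ₗ b)) (∙-congˡ (⁻¹-cong (sym (*ₗ-assoc t c b))))) (*-∈ t v∈)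
    }
    where open IsSubspace (inSpan-isSubspace bs)

  combination-inSpan : ∀ {n} c (b : Fin n → Carrier) → InSpan (tabulate b) (combination V c b)
  combination-inSpan {zero}  c b = ≈-refl
  combination-inSpan {suc n} c b = c zero ,
    IsSubspace.resp (inSpan-isSubspace (tabulate λ i → b (suc i))) (sym (xyx⁻¹≈y _ _))
      (combination-inSpan (λ i → c (suc i)) (λ i → b (suc i)))

  -- One step of Gaussian elimination: `s` has a nonzero coefficient `d` at `b`, so subtracting
  -- `c / d` times `s` removes `b` from `v`.
  eliminate : ∀ b bs {v s} → InSpan (b ∷ bs) s → ¬ InSpan bs s → InSpan (b ∷ bs) v →
              ∃[ k ] InSpan bs (v - k *ₗ s)
  eliminate b bs {v} {s} (d , s∈) s∉ (c , v∈) = k , resp eq (-‿∈ v∈ (*-∈ k s∈))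
    where
    open IsSubspace (inSpan-isSubspace bs)
    d≉0 : ¬ d ℝ.≈ ℝ.0#
    d≉0 d≈0 = s∉ (resp (trans (∙-congˡ (⁻¹-cong (trans (*ₗ-cong d≈0 ≈-refl) (*ₗ-zeroˡ b)))) (x-ε≈x s)) s∈)
    d⁻¹ = proj₁ (ℝ.inverse d d≉0)
    k = c ℝ.* d⁻¹
    k*[d*b]≈c*b : k *ₗ (d *ₗ b) ≈ c *ₗ b
    k*[d*b]≈c*b = trans (sym (*ₗ-assoc k d b)) (*ₗ-cong (ℝ.trans (ℝ.*-assoc c d⁻¹ d)
      (ℝ.trans (ℝ.*-congˡ (ℝ.trans (ℝ.*-comm d⁻¹ d) (proj₂ (ℝ.inverse d d≉0)))) (ℝ.*-identityʳ c))) ≈-refl)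
    eq : (v - c *ₗ b) - k *ₗ (s - d *ₗ b) ≈ v - k *ₗ s
    eq = begin
      (v - c *ₗ b) - k *ₗ (s - d *ₗ b)                ≈⟨ ∙-congˡ (⁻¹-cong (*ₗ-distrib-- k s (d *ₗ b))) ⟩
      (v - c *ₗ b) - (k *ₗ s - k *ₗ (d *ₗ b))         ≈⟨ ∙-congˡ (⁻¹-cong (∙-congˡ (⁻¹-cong k*[d*b]≈c*b))) ⟩
      (v - c *ₗ b) - (k *ₗ s - c *ₗ b)                ≈⟨ [x-y]-[z-y]≈x-z v (c *ₗ b) (k *ₗ s) ⟩
      v - k *ₗ s                                      ∎
      where open ≈-Reasoning setoid

  HasProjections : (Carrier → Set ℓ) → Set ℓ
  HasProjections S = ∀ v → ∃[ p ] S p × (∀ {x} → S x → v - p ⊥ x)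

  -- For s in S outside the span of bs, S is the orthogonal sum of S₀ = S ∩ span bs
  -- and the line through s₁, the component of s orthogonal to S₀.
  inSpan⇒hasProjections : ∀ bs {S} → IsSubspace S → (∀ {v} → S v → InSpan bs v) → HasProjections S
  inSpan⇒hasProjections [] S-sub S⊆0 v = ε , IsSubspace.0-∈ S-sub ,
    λ Sx → IsSubspace.resp (⊥ʳ-isSubspace _) (sym (S⊆0 Sx)) (IsSubspace.0-∈ (⊥ʳ-isSubspace _))
  inSpan⇒hasProjections (b ∷ bs) {S} S-sub S⊆ v
    with ℝ.excludedMiddle {∃[ s ] S s × ¬ InSpan bs s}
  ... | no ∄s = inSpan⇒hasProjections bs S-sub S⊆bs v
    where
    S⊆bs : ∀ {x} → S x → InSpan bs x
    S⊆bs {x} Sx with ℝ.excludedMiddle {InSpan bs x}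
    ... | yes x∈ = x∈
    ... | no  x∉ = ⊥-elim (∄s (x , Sx , x∉))
  ... | yes (s , Ss , s∉) = p , Sp , v-p⊥S
    where
    open IsSubspace S-sub
    module I = IsSubspace (inSpan-isSubspace bs)
    S₀ : Carrier → Set ℓ
    S₀ x = S x × InSpan bs x
    project : HasProjections S₀
    project = inSpan⇒hasProjections bs (record
      { resp = λ v≈w (Sv , v∈) → resp v≈w Sv , I.resp v≈w v∈
      ; 0-∈ = 0-∈ , I.0-∈
      ; +-∈ = λ (Sv , v∈) (Sw , w∈) → +-∈ Sv Sw , I.+-∈ v∈ w∈
      ; *-∈ = λ t (Sv , v∈) → *-∈ t Sv , I.*-∈ t v∈
      }) proj₂
    p₀ = proj₁ (project s)
    S₀p₀ = proj₁ (proj₂ (project s))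
    s₁ = s - p₀
    s₁⊥S₀ : ∀ {x} → S₀ x → s₁ ⊥ x
    s₁⊥S₀ = proj₂ (proj₂ (project s))
    pᵥ = proj₁ (project v)
    S₀pᵥ = proj₁ (proj₂ (project v))
    v-pᵥ⊥S₀ : ∀ {x} → S₀ x → v - pᵥ ⊥ x
    v-pᵥ⊥S₀ = proj₂ (proj₂ (project v))
    -- If `s₁` were zero, `s` would equal `p₀` and lie in the span of `bs`.
    q⁻¹ = ℝ.inverse ⟨ s₁ , s₁ ⟩ λ s₁⊥s₁ →
      s∉ (I.resp (sym (x∙y⁻¹≈ε⇒x≈y s p₀ (⟨⟩-definite s₁⊥s₁))) (proj₂ S₀p₀))
    -- The coefficient of `v - pᵥ` along `s₁`; as `s₁` is orthogonal to `S₀`, this correction keeps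
    -- orthogonality to `S₀`.
    t = ⟨ v - pᵥ , s₁ ⟩ ℝ.* proj₁ q⁻¹
    p = pᵥ ∙ (t *ₗ s₁)
    Sp : S p
    Sp = +-∈ (proj₁ S₀pᵥ) (*-∈ t (-‿∈ Ss (proj₁ S₀p₀)))
    v-p≈ : v - p ≈ (v - pᵥ) - t *ₗ s₁
    v-p≈ = x-[y∙z]≈x-y-z v pᵥ (t *ₗ s₁)
    v-p⊥S₀ : ∀ {x} → S₀ x → v - p ⊥ x
    v-p⊥S₀ {x} S₀x = P.resp (sym v-p≈) (P.-‿∈ (v-pᵥ⊥S₀ S₀x) (P.*-∈ t (s₁⊥S₀ S₀x)))
      where module P = IsSubspace (⊥-isSubspace x)
    v-p⊥s₁ : v - p ⊥ s₁
    v-p⊥s₁ = begin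
      ⟨ v - p , s₁ ⟩                                          ≈⟨ ⟨⟩-cong v-p≈ ≈-refl ⟩
      ⟨ (v - pᵥ) - t *ₗ s₁ , s₁ ⟩                             ≈⟨ ℝ.trans (⟨⟩-+ _ _ s₁) (ℝ.+-congˡ ⟨-t*s₁,s₁⟩≈) ⟩
      ⟨ v - pᵥ , s₁ ⟩ ℝ.- t ℝ.* ⟨ s₁ , s₁ ⟩                   ≈⟨ ℝ.+-congˡ (ℝ.-‿cong t*q≈) ⟩
      ⟨ v - pᵥ , s₁ ⟩ ℝ.- ⟨ v - pᵥ , s₁ ⟩                     ≈⟨ ℝ.-‿inverseʳ _ ⟩
      ℝ.0#                                                    ∎
      where
      open ≈-Reasoning ℝ.setoid
      ⟨-t*s₁,s₁⟩≈ : ⟨ (t *ₗ s₁) ⁻¹ , s₁ ⟩ ℝ.≈ ℝ.- (t ℝ.* ⟨ s₁ , s₁ ⟩)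
      ⟨-t*s₁,s₁⟩≈ = ℝ.trans (⟨⟩-⁻¹ _ s₁) (ℝ.-‿cong (⟨⟩-* t s₁ s₁))
      t*q≈ : t ℝ.* ⟨ s₁ , s₁ ⟩ ℝ.≈ ⟨ v - pᵥ , s₁ ⟩
      t*q≈ = ℝ.trans (ℝ.*-assoc _ _ _) (ℝ.trans
        (ℝ.*-congˡ (ℝ.trans (ℝ.*-comm _ _) (proj₂ q⁻¹))) (ℝ.*-identityʳ _))
    v-p⊥S : ∀ {x} → S x → v - p ⊥ x
    -- Decompose `x` as `x - k *ₗ s`, which lies in `S₀`, plus `k` times `s = s₁ + p₀`; `v - p` is
    -- orthogonal to every piece.
    v-p⊥S {x} Sx with eliminate b bs (S⊆ Ss) s∉ (S⊆ Sx)
    ... | k , x-ks∈ = P.resp (//-rightDividesˡ (k *ₗ s) x)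
      (P.+-∈ (v-p⊥S₀ (-‿∈ Sx (*-∈ k Ss) , x-ks∈))
        (P.*-∈ k (P.resp (//-rightDividesˡ p₀ s) (P.+-∈ v-p⊥s₁ (v-p⊥S₀ S₀p₀)))))
      where module P = IsSubspace (⊥ʳ-isSubspace (v - p))

  hasProjections : ∀ {d} → HasDimension V d → ∀ {S} → IsSubspace S → HasProjections S
  hasProjections (b , _ , spans) S-sub = inSpan⇒hasProjections (tabulate b) S-sub λ {v} _ →
    IsSubspace.resp (inSpan-isSubspace (tabulate b)) (sym (proj₂ (spans v)))
      (combination-inSpan (proj₁ (spans v)) b)

-- The bound by the effective factor.

module EffectiveFactor {ℓ : Level} {ℝ : CompleteOrderedField ℓ} (V : NormedSpace ℝ) (U : UltrametricGroup ℝ)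
                       (Λ : Subgroup (ambient V U)) (closed : IsClosed Λ)
                       (ip : InnerProduct V) {d : ℕ} (dim : HasDimension V d) where
  private
    module ℝ = OrderedFieldLemmas ℝ
    module U = UltrametricLemmas U
    module X = NormedGroupLemmas (X V U Λ closed)
  open ℝ using (_≤ᴿ_; _<ᴿ_)
  open NormedSpaceLemmas V
  open InnerProductLemmas V ip
  open Lifting V U Λ closed

  private
    infix 4 _⟶_
    _⟶_ : Carrier → Carrier → Set ℓ
    v ⟶ p = IsProjection V U Λ ip v p

    E : Carrier → Set ℓ
    E = Span V λ p → ∃[ v ] ∃[ u ] Λ ∋ (v , u) × v ⟶ p

  W-isSubspace : IsSubspace (W V U Λ ∋_)
  W-isSubspace = record { resp = W.∋-resp ; 0-∈ = W.∋-ε ; +-∈ = W.∋-∙ ; *-∈ = W-* }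
    where module W = Subgroup (W V U Λ)

  private
    module W = IsSubspace W-isSubspace
    module E = IsSubspace (span-isSubspace λ p → ∃[ v ] ∃[ u ] Λ ∋ (v , u) × v ⟶ p)

  project : ∀ v → ∃[ p ] v ⟶ p
  project v with hasProjections dim W-isSubspace v
  ... | w , Ww , v-w⊥W = v - w , v-w⊥W , W.resp (sym (x-[x-y]≈y v w)) Ww

  ⟶-· : ∀ n {v p} → v ⟶ p → n · v ⟶ n · p
  ⟶-· n {v} {p} (p⊥W , W∋v-p) =
    (λ Ww → IsSubspace.·-∈ (⊥-isSubspace _) n (p⊥W Ww)) ,
    W.resp (·-distrib-- n v p) (W.·-∈ n W∋v-p)

  ⟶-- : ∀ {v p v′ p′} → v ⟶ p → v′ ⟶ p′ → v - v′ ⟶ p - p′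
  ⟶-- {v} {p} {v′} {p′} (p⊥W , W∋v-p) (p′⊥W , W∋v′-p′) =
    (λ Ww → IsSubspace.-‿∈ (⊥-isSubspace _) (p⊥W Ww) (p′⊥W Ww)) ,
    W.resp (//-interchange v p v′ p′) (W.-‿∈ W∋v-p W∋v′-p′)

  -- Pythagoras for `v = p + (v - p)`; projected lifts thus stay shorter than `δ`.
  ‖p‖≤‖v‖ : ∀ {v p} → v ⟶ p → ‖ p ‖ ≤ᴿ ‖ v ‖
  ‖p‖≤‖v‖ {v} {p} (p⊥W , W∋v-p) = ℝ.square-cancel-≤ (‖‖-nonneg v) (ℝ.≤-trans (⊥⇒‖v‖²≤‖v+w‖² (p⊥W W∋v-p))
    (ℝ.≤-reflexive (‖‖²-cong (trans (comm p (v - p)) (//-rightDividesˡ p v)))))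

  ·-proj₁ : ∀ n (α : X.Carrier) → proj₁ (n X.· α) ≈ n · proj₁ α
  ·-proj₁ zero    α = ≈-refl
  ·-proj₁ (suc n) α = ∙-congˡ (·-proj₁ n α)

  module _ {α : X.Carrier} {r : ℕ} (S : SeparatedMultiples (X V U Λ closed) α r) where
    open SeparatedMultiples S
    private module L i = Lift (lifts S i)

    aᵖ : ∃[ p ] proj₁ α ⟶ p
    aᵖ = project (proj₁ α)

    split : ∃[ e ] E e × (∀ {x} → E x → proj₁ aᵖ - e ⊥ x)
    split = hasProjections dim (span-isSubspace _) (proj₁ aᵖ)

    f : Carrier
    f = proj₁ aᵖ - proj₁ split

    f⊥E : ∀ {x} → E x → f ⊥ x
    f⊥E = proj₂ (proj₂ split)

    vᵖ : ∀ i → ∃[ p ] L.v i ⟶ p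
    vᵖ i = project (L.v i)

    e : Fin r → Carrier
    e i = proj₁ (vᵖ i) - time i · f

    -- The E⊥-component of the lift of n α is n times that of α, since lifts of
    -- n α differ from n times a lift of α by an element of Λ.
    E∋e : ∀ i → E (e i)
    -- The difference of `n · α` and its lift lies in `Λ`, so its projection `n · proj₁ aᵖ - p` is
    -- in `E`; subtracting it from `n · proj₁ split` gives `e i`.
    E∋e i = E.resp eq (E.-‿∈ (E.·-∈ n (proj₁ (proj₂ split)))
      (generator (_ , _ , Subgroup.∋-resp Λ (∙-congʳ (·-proj₁ n α) , U.≈-refl) (L.lift i) ,
        ⟶-- (⟶-· n (proj₂ aᵖ)) (proj₂ (vᵖ i)))))
      where
      n = time i
      p = proj₁ (vᵖ i)
      eq : n · proj₁ split - (n · proj₁ aᵖ - p) ≈ e i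
      eq = trans (sym (x-[y-z]≈z-[y-x] p (n · proj₁ aᵖ) (n · proj₁ split)))
        (∙-congˡ (⁻¹-cong (sym (·-distrib-- n (proj₁ aᵖ) (proj₁ split)))))

    n·f⊥E : ∀ n {x} → E x → n · f ⊥ x
    n·f⊥E n Ex = IsSubspace.·-∈ (⊥-isSubspace _) n (f⊥E Ex)

    -- The component n · f orthogonal to E has n ≥ K for a lift and n ≤ K for a
    -- difference of two lifts, so removing it by Pythagoras keeps the order of
    -- the norms, which are < δ for a lift and ≥ δ for a difference.
    e-< : ∀ i {j k} → ¬ j ≡ k → ‖ e i ‖ <ᴿ ‖ e j - e k ‖
    e-< i {j} {k} j≢k = ℝ.square-cancel-< (‖‖-nonneg _) (ℝ.≰⇒> λ ejk²≤ei² →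
      ℝ.<⇒≱ (ℝ.square-mono-< (‖‖-nonneg _) (ℝ.≤-<-trans (‖p‖≤‖v‖ (proj₂ (vᵖ i))) (L.v<δ i))) (begin
        δ ℝ.* δ                               ≤⟨ ℝ.square-mono-≤ (proj₁ (0<δ S i)) δ≤ ⟩
        ‖ proj₁ (vᵖ j) - proj₁ (vᵖ k) ‖²      ≈⟨ ‖‖²-cong split-difference ⟩
        ‖ (e j - e k) ∙ g ‖²                  ≈⟨ pythagoras (⊥-sym g⊥) ⟩
        ‖ e j - e k ‖² ℝ.+ᴿ ‖ g ‖²            ≤⟨ ℝ.+-mono-≤ ejk²≤ei² (ℝ.square-mono-≤ (‖‖-nonneg g) ‖g‖≤) ⟩
        ‖ e i ‖² ℝ.+ᴿ ‖ time i · f ‖²         ≈⟨ pythagoras (⊥-sym (n·f⊥E (time i) (E∋e i))) ⟨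
        ‖ e i ∙ (time i · f) ‖²               ≈⟨ ‖‖²-cong (//-rightDividesˡ (time i · f) (proj₁ (vᵖ i))) ⟩
        ‖ proj₁ (vᵖ i) ‖²                     ∎))
      where
      open ≤-Reasoning ℝ.poset
      g : Carrier
      g = time j · f - time k · f
      E∋ejk : E (e j - e k)
      E∋ejk = E.-‿∈ (E∋e j) (E∋e k)
      g⊥ : g ⊥ e j - e k
      g⊥ = IsSubspace.-‿∈ (⊥-isSubspace _) (n·f⊥E (time j) E∋ejk) (n·f⊥E (time k) E∋ejk)
      ‖g‖≤ : ‖ g ‖ ≤ᴿ ‖ time i · f ‖
      ‖g‖≤ = ℝ.≤-trans (ℝ.≤-reflexive (dist-· (time j) (time k) f))
        (‖·‖-mono-≤ f (ℕ.≤-trans (gap j k) (K≤time i)))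
      δ≤ : δ ≤ᴿ ‖ proj₁ (vᵖ j) - proj₁ (vᵖ k) ‖
      -- Replacing a lift by its projection shifts it by an element of `W`, which changes neither
      -- its class nor its `U`-component.
      δ≤ = lift-separated S j≢k
        (W-shift _ (proj₂ (proj₂ (vᵖ j)))) (W-shift _ (proj₂ (proj₂ (vᵖ k))))
      split-difference : proj₁ (vᵖ j) - proj₁ (vᵖ k) ≈ (e j - e k) ∙ g
      split-difference =
        trans (∙-cong (sym (//-rightDividesˡ _ _)) (⁻¹-cong (sym (//-rightDividesˡ _ _))))
          (//-∙-distrib _ _ _ _)

  -- Removing the multiples of `f` may bring the differences below `δ`, so the scale comes from
  -- `separating-constant` instead. That choice needs an index, whence the case split on `r`.
  effectiveFactor-bound : ∀ {α r} → SeparatedMultiples (X V U Λ closed) α r →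
                          ∀ {P} → IsPackingNumber (effectiveFactor V U Λ ip) P → r ≤ P
  effectiveFactor-bound {r = zero}  S isP = z≤n
  effectiveFactor-bound {r = suc r} S isP = packing-bound (effectiveFactor V U Λ ip) isP
    (λ i → s *ₗ e S i , s *ˢ E∋e S i)
    (λ i → ‖v‖<c⇒‖sv‖<1 (e<c i))
    (λ i≢j → ℝ.≤-trans (c≤‖v‖⇒1≤‖sv‖ (c≤ i≢j)) (ℝ.≤-reflexive (‖‖-cong (*ₗ-distrib-- s _ _))))
    where
    separating : ∃[ c ] (∀ i → ‖ e S i ‖ <ᴿ c) × (∀ {j k} → ¬ j ≡ k → c ≤ᴿ ‖ e S j - e S k ‖)
    separating = ℝ.separating-constant (λ i → ‖ e S i ‖) (λ j k → ‖ e S j - e S k ‖) (e-< S)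
    e<c = proj₁ (proj₂ separating)
    c≤ : ∀ {j k} → ¬ j ≡ k → proj₁ separating ≤ᴿ ‖ e S j - e S k ‖
    c≤ = proj₂ (proj₂ separating)
    open Rescale (ℝ.≤-<-trans (‖‖-nonneg (e S zero)) (e<c zero))

theorem1 : ∀ {ℓ} (ℝ : CompleteOrderedField ℓ)
    (V : NormedSpace ℝ) (d : ℕ) → 1 ≤ d → HasDimension V d →
    (U : UltrametricGroup ℝ)
    (Λ : Subgroup (ambient V U)) (closed : IsClosed Λ) →
    (∀ P → IsPackingNumber (reducedFactor V U Λ closed) P →
    ∀ α N → 2 ≤ N →
    ∃[ g ] IsDistanceCount (X V U Λ closed) N α g × g ≤ P + 1)
    ×
    (∀ (ip : InnerProduct V) P → IsPackingNumber (effectiveFactor V U Λ ip) P →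
    ∀ α N → 2 ≤ N →
    ∃[ g ] IsDistanceCount (X V U Λ closed) N α g × g ≤ P + 1)
theorem1 ℝ V d _ dim U Λ closed =
  (λ P isP α N 2≤N → bounded α N 2≤N λ S → Lifting.reducedFactor-bound V U Λ closed S isP) ,
  (λ ip P isP α N 2≤N → bounded α N 2≤N λ S → EffectiveFactor.effectiveFactor-bound V U Λ closed ip dim S isP)
  where
  -- The two halves of the theorem differ only in how they bound the number of separated multiples.
  bounded : ∀ {P} α N → 2 ≤ N → (∀ {r} → SeparatedMultiples (X V U Λ closed) α r → r ≤ P) →
            ∃[ g ] IsDistanceCount (X V U Λ closed) N α g × g ≤ P + 1
  bounded α N 2≤N r≤P with distanceCount (X V U Λ closed) α N 2≤N
  ... | g , count , r , g≤r+1 , S = g , count , ℕ.≤-trans g≤r+1 (ℕ.+-monoˡ-≤ 1 (r≤P S))
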